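{- Let $\mathcal{A}=(a_{i_1\ldots i_k})$ be a weakly irreducible symmetric tensor of order $k\ge 2$ and dimension $n\ge 2$ (with complex entries) such that $a_{i_1\ldots i_k}\ne 0$ only when the indices $i_1,\ldots,i_k$ are either all equal or pairwise distinct. For every $k$-set $e=\{i_1,\ldots,i_k\}\subseteq[n]$ corresponding to a nonzero off-diagonal entry, define $c_e=(k-1)!\,a_{i_1\ldots i_k}$ (well defined because $\mathcal{A}$ is symmetric). Let $\lambda$ be an eigenvalue of $\mathcal{A}$, and let $p\in\mathbb{V}_\lambda(\mathcal{A})$ be an isolated point. Suppose that (1) $p$ has no zero entries; (2) there is an $\alpha\in\mathbb{R}$ such that $c_ep^e=|c_ep^e|e^{\mathbf{i}\alpha}$ for every such $k$-set $e$, where $p^e=\prod_{i\in e}p_i$ and $\mathbf{i}=\sqrt{ -1}$. Then the local intersection multiplicity of $p$ with respect to the homogeneous eigen-equation ideal defining $\mathbb{V}_\lambda(\mathcal{A})$ is $1$.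
   Context: Let $[n]=\{1,\ldots,n\}$. A tensor $\mathcal{A}=(a_{i_1\ldots i_k})$ of order $k$ and dimension $n$ is an array of entries $a_{i_1\ldots i_k}\in\mathbb{C}$, $i_1,\ldots,i_k\in[n]$; it is symmetric if its entries are invariant under all permutations of the indices. For $x\in\mathbb{C}^n$, $(\mathcal{A}x^{k-1})_i=\sum_{i_2,\ldots,i_k\in[n]}a_{ii_2\ldots i_k}x_{i_2}\cdots x_{i_k}$, and $x^{[k-1]}=(x_1^{k-1},\ldots,x_n^{k-1})$. A number $\lambda\in\mathbb{C}$ is an eigenvalue of $\mathcal{A}$ if $\mathcal{A}x^{k-1}=\lambda x^{[k-1]}$ for some $x\in\mathbb{C}^n\setminus\{0\}$. The projective eigenvariety is $\mathbb{V}_\lambda(\mathcal{A})=\{x\in\mathbb{P}^{n-1}:\mathcal{A}x^{k-1}=\lambda x^{[k-1]}\}$, with $\mathbb{P}^{n-1}$ complex projective space. (Conditions (1) and (2) refer to a representative vector of $p$; they do not depend on its choice, up to a common change of $\alpha$.) The directed graph $D(\mathcal{A})$ has vertices $1,\ldots,n$ and an arc $(i,j)$ if and only if there is a nonzero entry $a_{ii_2\ldots i_k}$ with $j\in\{i_2,\ldots,i_k\}$. The tensor $\mathcal{A}$ is weakly irreducible if $D(\mathcal{A})$ is strongly connected. The homogeneous eigen-equation ideal is generated by $F_i=\lambda x_i^{k-1}-(\mathcal{A}x^{k-1})_i$, $i\in[n]$. The local intersection multiplicity of an isolated point $p$ is computed on any affine chart containing $p$: if $p_j\ne 0$, normalize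 $p_j=1$, let $f_i$ be obtained from $F_i$ by setting $x_j=1$, let $\tilde p\in\mathbb{C}^{n-1}$ be $p$ with the $j$-th coordinate removed, let $S=\mathbb{C}[x_i: i\in[n]\setminus\{j\}]$ and let $M_{\tilde p}$ be the maximal ideal of $S$ corresponding to $\tilde p$; then the multiplicity is $\dim_{\mathbb{C}} S_{M_{\tilde p}}/\langle f_1,\ldots,f_n\rangle S_{M_{\tilde p}}$. It does not depend on the chart. -}

module Defs where

open import Algebra.Bundles using (CommutativeRing; RawSemiring; Semiring)
import Algebra.Definitions.RawSemiring as RawSemiringDefinitions
import Algebra.Properties.AbelianGroup as AbelianGroupProperties
import Algebra.Properties.Ring as RingProperties
import Algebra.Properties.Semiring.Sum as SemiringSum
import Algebra.Solver.Ring.NaturalCoefficients.Default as SemiringSolver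
open import Data.Empty using (⊥-elim)
open import Data.Fin.Base using (Fin; zero; suc; toℕ)
open import Data.Fin.Permutation using (Permutation′; _⟨$⟩ʳ_)
open import Data.Nat.Base as ℕ using (ℕ; zero; suc; _!)
open import Data.Product.Base using (Σ; ∃; ∃₂; _×_; _,_; proj₁; proj₂)
open import Data.Sum.Base using (_⊎_; inj₁; inj₂)
open import Data.Vec.Base using (Vec; []; _∷_; lookup; tabulate)
open import Data.Vec.Functional using (Vector; insertAt; removeAt)
open import Data.Vec.Membership.Propositional using (_∈_)
open import Data.Vec.Relation.Unary.AllPairs using (AllPairs)
open import Data.Vec.Relation.Unary.Unique.Propositional using (Unique)
open import Function.Base using (id; _∘_)
open import Level using (0ℓ)
open import Relation.Binary.Construct.Closure.ReflexiveTransitive using (Star)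
open import Relation.Binary.Core using (Rel)
open import Relation.Binary.Definitions using (tri<; tri≈; tri>)
open import Relation.Binary.PropositionalEquality.Core using (_≡_)
open import Relation.Binary.Structures using (IsStrictTotalOrder)
open import Relation.Nullary using (¬_)
open import Relation.Unary using (Pred)

rawSemiringOf : CommutativeRing 0ℓ 0ℓ → RawSemiring 0ℓ 0ℓ
rawSemiringOf R = Semiring.rawSemiring (CommutativeRing.semiring R)

-- The real numbers, given by their axioms: a Dedekind-complete ordered field
-- (unique up to unique isomorphism).  The inverse is a total function whose
-- value at 0 is unspecified.

record CompleteOrderedField : Set₁ where
  field
    commutativeRing : CommutativeRing 0ℓ 0ℓ
  open CommutativeRing commutativeRing public
  infix 4 _<_ _≤_
  infix 8 _⁻¹
  field
    1≉0                : ¬ (1# ≈ 0#)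
    _⁻¹                : Carrier → Carrier
    *-inverseʳ         : ∀ x → ¬ (x ≈ 0#) → x * x ⁻¹ ≈ 1#
    _<_                : Rel Carrier 0ℓ
    isStrictTotalOrder : IsStrictTotalOrder _≈_ _<_
    +-monoˡ-<          : ∀ {x y} z → x < y → x + z < y + z
    *-pos              : ∀ {x y} → 0# < x → 0# < y → 0# < x * y

  _≤_ : Rel Carrier 0ℓ
  x ≤ y = x < y ⊎ x ≈ y

  UpperBound : Pred Carrier 0ℓ → Pred Carrier 0ℓ
  UpperBound P b = ∀ x → P x → x ≤ b

  field
    complete : (P : Pred Carrier 0ℓ) → ∃ P → ∃ (UpperBound P) →
               ∃ λ s → UpperBound P s × (∀ b → UpperBound P b → s ≤ b)

-- The polynomial ring R[x_v : v ∈ V], presented as the free commutative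
-- R-algebra on V: expressions modulo the least congruence that makes them a
-- commutative ring and `con` a ring homomorphism.

module Polynomials (R : CommutativeRing 0ℓ 0ℓ) where
  private module R = CommutativeRing R

  infixl 7 _⊗_
  infixl 6 _⊕_
  infix 4 _≋_

  data Poly (V : Set) : Set where
    con     : R.Carrier → Poly V
    var     : V → Poly V
    _⊕_ _⊗_ : Poly V → Poly V → Poly V
    ⊝_      : Poly V → Poly V

  data _≋_ {V : Set} : Rel (Poly V) 0ℓ where
    ≋-refl       : ∀ {f} → f ≋ f
    ≋-sym        : ∀ {f g} → f ≋ g → g ≋ f
    ≋-trans      : ∀ {f g h} → f ≋ g → g ≋ h → f ≋ h
    ⊕-cong       : ∀ {f f′ g g′} → f ≋ f′ → g ≋ g′ → f ⊕ g ≋ f′ ⊕ g′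
    ⊗-cong       : ∀ {f f′ g g′} → f ≋ f′ → g ≋ g′ → f ⊗ g ≋ f′ ⊗ g′
    ⊝-cong       : ∀ {f f′} → f ≋ f′ → ⊝ f ≋ ⊝ f′
    ⊕-assoc      : ∀ f g h → (f ⊕ g) ⊕ h ≋ f ⊕ (g ⊕ h)
    ⊕-comm       : ∀ f g → f ⊕ g ≋ g ⊕ f
    ⊕-identityʳ  : ∀ f → f ⊕ con R.0# ≋ f
    ⊕-inverseʳ   : ∀ f → f ⊕ (⊝ f) ≋ con R.0#
    ⊗-assoc      : ∀ f g h → (f ⊗ g) ⊗ h ≋ f ⊗ (g ⊗ h)
    ⊗-comm       : ∀ f g → f ⊗ g ≋ g ⊗ f
    ⊗-identityʳ  : ∀ f → f ⊗ con R.1# ≋ f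
    ⊗-distribˡ-⊕ : ∀ f g h → f ⊗ (g ⊕ h) ≋ (f ⊗ g) ⊕ (f ⊗ h)
    con-cong     : ∀ {a b} → a R.≈ b → con a ≋ con b
    con-+        : ∀ a b → con (a R.+ b) ≋ con a ⊕ con b
    con-*        : ∀ a b → con (a R.* b) ≋ con a ⊗ con b

  polynomialRing : Set → CommutativeRing 0ℓ 0ℓ
  polynomialRing V = record
    { Carrier = Poly V ; _≈_ = _≋_ ; _+_ = _⊕_ ; _*_ = _⊗_ ; -_ = ⊝_
    ; 0# = con R.0# ; 1# = con R.1#
    ; isCommutativeRing = record
      { isRing = record
        { +-isAbelianGroup = record
          { isGroup = record
            { isMonoid = record
              { isSemigroup = record
                { isMagma = record
                  { isEquivalence = record
                    { refl = ≋-refl ; sym = ≋-sym ; trans = ≋-trans }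
                  ; ∙-cong = ⊕-cong }
                ; assoc = ⊕-assoc }
              ; identity =
                  (λ f → ≋-trans (⊕-comm _ f) (⊕-identityʳ f)) , ⊕-identityʳ }
            ; inverse =
                (λ f → ≋-trans (⊕-comm _ f) (⊕-inverseʳ f)) , ⊕-inverseʳ
            ; ⁻¹-cong = ⊝-cong }
          ; comm = ⊕-comm }
        ; *-cong = ⊗-cong
        ; *-assoc = ⊗-assoc
        ; *-identity =
            (λ f → ≋-trans (⊗-comm _ f) (⊗-identityʳ f)) , ⊗-identityʳ
        ; distrib = ⊗-distribˡ-⊕ , λ f g h →
            ≋-trans (⊗-comm (g ⊕ h) f)
              (≋-trans (⊗-distribˡ-⊕ f g h) (⊕-cong (⊗-comm f g) (⊗-comm f h)))
        }
      ; *-comm = ⊗-comm } }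

  -- Evaluation at `x` in an R-algebra T with structure map `ι`.

  module _ (T : CommutativeRing 0ℓ 0ℓ) where
    private module T = CommutativeRing T

    evalIn : (R.Carrier → T.Carrier) → ∀ {V} → (V → T.Carrier) → Poly V → T.Carrier
    evalIn ι x (con a) = ι a
    evalIn ι x (var v) = x v
    evalIn ι x (f ⊕ g) = evalIn ι x f T.+ evalIn ι x g
    evalIn ι x (f ⊗ g) = evalIn ι x f T.* evalIn ι x g
    evalIn ι x (⊝ f)   = T.- evalIn ι x f

  eval : ∀ {V} → (V → R.Carrier) → Poly V → R.Carrier
  eval = evalIn R id

  substitute : ∀ {V W} → (V → Poly W) → Poly V → Poly W
  substitute = evalIn (polynomialRing _) con

-- The localization D⁻¹S at a multiplicative set D.

module Localization
  (S : CommutativeRing 0ℓ 0ℓ)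
  (D : Pred (CommutativeRing.Carrier S) 0ℓ)
  (1∈D : D (CommutativeRing.1# S))
  (*-closed : ∀ {s t} → D s → D t → D (CommutativeRing._*_ S s t))
  where
  private module S = CommutativeRing S
  open S using (_+_; _*_; -_; 0#; 1#; _≈_; refl; sym; trans)
  private module S′ = RingProperties S.ring
  open SemiringSolver S.commutativeSemiring using (solve; _:=_; _:+_; _:*_) renaming (con to κ)

  infix 6 _÷_[_]

  record Fraction : Set where
    constructor _÷_[_]
    field
      num : S.Carrier
      den : S.Carrier
      den∈D : D den

  open Fraction public

  infix 4 _≃_

  record _≃_ (x y : Fraction) : Set where
    constructor scale
    field
      factor   : S.Carrier
      factor∈D : D factor
      equality : factor * (num x * den y) ≈ factor * (num y * den x)

  fromS : S.Carrier → Fraction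
  fromS a = a ÷ 1# [ 1∈D ]

  private
    _⊕_ _⊗_ : Fraction → Fraction → Fraction
    x ⊕ y = (num x * den y + num y * den x) ÷ den x * den y [ *-closed (den∈D x) (den∈D y) ]
    x ⊗ y = (num x * num y) ÷ den x * den y [ *-closed (den∈D x) (den∈D y) ]

    ⊝_ : Fraction → Fraction
    ⊝ x = (- num x) ÷ den x [ den∈D x ]

    cross : ∀ {x y} → num x * den y ≈ num y * den x → x ≃ y
    cross e = scale 1# 1∈D (S.*-congˡ e)

    ≃-trans : ∀ {x y z} → x ≃ y → y ≃ z → x ≃ z
    ≃-trans {a ÷ s [ s∈ ]} {b ÷ t [ t∈ ]} {c ÷ r [ r∈ ]} (scale u u∈ p) (scale v v∈ q) =
      scale ((u * v) * t) (*-closed (*-closed u∈ v∈) t∈)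
      (trans (solve 5 (λ u v t a r → ((u :* v) :* t) :* (a :* r) := (v :* r) :* (u :* (a :* t)))
                   refl u v t a r)
      (trans (S.*-congˡ p)
      (trans (solve 5 (λ u v b r s → (v :* r) :* (u :* (b :* s)) := (u :* s) :* (v :* (b :* r)))
                    refl u v b r s)
      (trans (S.*-congˡ q)
             (solve 5 (λ u v t c s → (u :* s) :* (v :* (c :* t)) := ((u :* v) :* t) :* (c :* s))
                    refl u v t c s)))))

    ⊕-cong : ∀ {x y z w} → x ≃ y → z ≃ w → (x ⊕ z) ≃ (y ⊕ w)
    ⊕-cong {a ÷ s [ _ ]} {b ÷ t [ _ ]} {c ÷ r [ _ ]} {d ÷ q [ _ ]} (scale u u∈ e) (scale v v∈ e′) =
      scale (u * v) (*-closed u∈ v∈)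
      (trans (solve 8 (λ u v a s c r t q →
                (u :* v) :* ((a :* r :+ c :* s) :* (t :* q))
                := (v :* r :* q) :* (u :* (a :* t)) :+ (u :* s :* t) :* (v :* (c :* q)))
                refl u v a s c r t q)
      (trans (S.+-cong (S.*-congˡ e) (S.*-congˡ e′))
             (solve 8 (λ u v b s d r t q →
                (v :* r :* q) :* (u :* (b :* s)) :+ (u :* s :* t) :* (v :* (d :* r))
                := (u :* v) :* ((b :* q :+ d :* t) :* (s :* r)))
                refl u v b s d r t q)))

    ⊗-cong : ∀ {x y z w} → x ≃ y → z ≃ w → (x ⊗ z) ≃ (y ⊗ w)
    ⊗-cong {a ÷ s [ _ ]} {b ÷ t [ _ ]} {c ÷ r [ _ ]} {d ÷ q [ _ ]} (scale u u∈ e) (scale v v∈ e′) =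
      scale (u * v) (*-closed u∈ v∈)
      (trans (solve 6 (λ u v a c t q →
                (u :* v) :* ((a :* c) :* (t :* q)) := (u :* (a :* t)) :* (v :* (c :* q)))
                refl u v a c t q)
      (trans (S.*-cong e e′)
             (solve 6 (λ u v b d s r →
                (u :* (b :* s)) :* (v :* (d :* r)) := (u :* v) :* ((b :* d) :* (s :* r)))
                refl u v b d s r)))

    ⊝-cong : ∀ {x y} → x ≃ y → (⊝ x) ≃ (⊝ y)
    ⊝-cong {a ÷ s [ _ ]} {b ÷ t [ _ ]} (scale u u∈ e) =
      scale u u∈ (trans (neg a t) (trans (S.-‿cong e) (sym (neg b s))))
      where
      neg : ∀ g h → u * (- g * h) ≈ - (u * (g * h))
      neg g h = trans (S.*-congˡ (sym (S′.-‿distribˡ-* g h))) (sym (S′.-‿distribʳ-* u (g * h)))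

    ⊕-comm : ∀ x y → (x ⊕ y) ≃ (y ⊕ x)
    ⊕-comm (a ÷ s [ _ ]) (b ÷ t [ _ ]) = cross (solve 4 (λ a s b t →
      (a :* t :+ b :* s) :* (t :* s) := (b :* s :+ a :* t) :* (s :* t)) refl a s b t)

    ⊕-assoc : ∀ x y z → ((x ⊕ y) ⊕ z) ≃ (x ⊕ (y ⊕ z))
    ⊕-assoc (a ÷ s [ _ ]) (b ÷ t [ _ ]) (c ÷ r [ _ ]) = cross (solve 6 (λ a s b t c r →
      ((a :* t :+ b :* s) :* r :+ c :* (s :* t)) :* (s :* (t :* r))
      := (a :* (t :* r) :+ (b :* r :+ c :* t) :* s) :* ((s :* t) :* r)) refl a s b t c r)

    ⊕-identityʳ : ∀ x → (x ⊕ fromS 0#) ≃ x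
    ⊕-identityʳ (a ÷ s [ _ ]) = cross (solve 2 (λ a s →
      (a :* κ 1 :+ κ 0 :* s) :* s := a :* (s :* κ 1)) refl a s)

    ⊕-inverseʳ : ∀ x → (x ⊕ (⊝ x)) ≃ fromS 0#
    ⊕-inverseʳ (a ÷ s [ _ ]) = cross
      (trans (S.*-identityʳ _)
      (trans (sym (S.distribʳ s a (- a)))
      (trans (S.*-congʳ (S.-‿inverseʳ a))
      (trans (S.zeroˡ s) (sym (S.zeroˡ _))))))

    ⊗-comm : ∀ x y → (x ⊗ y) ≃ (y ⊗ x)
    ⊗-comm (a ÷ s [ _ ]) (b ÷ t [ _ ]) = cross (solve 4 (λ a s b t →
      (a :* b) :* (t :* s) := (b :* a) :* (s :* t)) refl a s b t)

    ⊗-assoc : ∀ x y z → ((x ⊗ y) ⊗ z) ≃ (x ⊗ (y ⊗ z))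
    ⊗-assoc (a ÷ s [ _ ]) (b ÷ t [ _ ]) (c ÷ r [ _ ]) = cross (solve 6 (λ a s b t c r →
      ((a :* b) :* c) :* (s :* (t :* r)) := (a :* (b :* c)) :* ((s :* t) :* r)) refl a s b t c r)

    ⊗-identityʳ : ∀ x → (x ⊗ fromS 1#) ≃ x
    ⊗-identityʳ (a ÷ s [ _ ]) = cross (solve 2 (λ a s →
      (a :* κ 1) :* s := a :* (s :* κ 1)) refl a s)

    ⊗-distribˡ-⊕ : ∀ x y z → (x ⊗ (y ⊕ z)) ≃ ((x ⊗ y) ⊕ (x ⊗ z))
    ⊗-distribˡ-⊕ (a ÷ s [ _ ]) (b ÷ t [ _ ]) (c ÷ r [ _ ]) = cross (solve 6 (λ a s b t c r →
      (a :* (b :* r :+ c :* t)) :* ((s :* t) :* (s :* r))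
      := ((a :* b) :* (s :* r) :+ (a :* c) :* (s :* t)) :* (s :* (t :* r))) refl a s b t c r)

  localization : CommutativeRing 0ℓ 0ℓ
  localization = record
    { Carrier = Fraction ; _≈_ = _≃_ ; _+_ = _⊕_ ; _*_ = _⊗_ ; -_ = ⊝_
    ; 0# = fromS 0# ; 1# = fromS 1#
    ; isCommutativeRing = record
      { isRing = record
        { +-isAbelianGroup = record
          { isGroup = record
            { isMonoid = record
              { isSemigroup = record
                { isMagma = record
                  { isEquivalence = record
                    { refl = cross refl ; sym = λ (scale u u∈ e) → scale u u∈ (sym e)
                    ; trans = ≃-trans }
                  ; ∙-cong = ⊕-cong }
                ; assoc = ⊕-assoc }
              ; identity =
                  (λ x → ≃-trans (⊕-comm (fromS 0#) x) (⊕-identityʳ x))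
                  , ⊕-identityʳ }
            ; inverse =
                (λ x → ≃-trans (⊕-comm (⊝ x) x) (⊕-inverseʳ x))
                , ⊕-inverseʳ
            ; ⁻¹-cong = ⊝-cong }
          ; comm = ⊕-comm }
        ; *-cong = ⊗-cong
        ; *-assoc = ⊗-assoc
        ; *-identity =
            (λ x → ≃-trans (⊗-comm (fromS 1#) x) (⊗-identityʳ x))
            , ⊗-identityʳ
        ; distrib = ⊗-distribˡ-⊕ , λ x y z →
            ≃-trans (⊗-comm (y ⊕ z) x)
              (≃-trans (⊗-distribˡ-⊕ x y z)
                (⊕-cong (⊗-comm x y) (⊗-comm x z)))
        }
      ; *-comm = ⊗-comm } }

-- The quotient T/⟨f₁,…,f_s⟩: the carrier of T with congruence modulo the ideal.

module Quotient
  (T : CommutativeRing 0ℓ 0ℓ)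
  {s : ℕ} (f : Vector (CommutativeRing.Carrier T) s)
  where
  private module T = CommutativeRing T
  open T using (_+_; _*_; -_; _-_; 0#; 1#; _≈_; refl; sym; trans)
  private
    module T′ = RingProperties T.ring
    module G = AbelianGroupProperties T.+-abelianGroup
  open SemiringSum T.semiring using (sum; sum-cong-≋; ∑-distrib-+; *-distribˡ-sum)
  open SemiringSolver T.commutativeSemiring using (solve; _:=_; _:+_; _:*_)

  InIdeal : Pred T.Carrier 0ℓ
  InIdeal x = ∃ λ (c : Vector T.Carrier s) → x ≈ sum (λ i → c i * f i)

  infix 4 _≡ᴵ_

  record _≡ᴵ_ (x y : T.Carrier) : Set where
    constructor congruent
    field
      difference : InIdeal (x - y)

  private
    +-closed : ∀ {x y} → InIdeal x → InIdeal y → InIdeal (x + y)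
    +-closed (c , p) (d , q) = (λ i → c i + d i) ,
      trans (T.+-cong p q) (trans (sym (∑-distrib-+ (λ i → c i * f i) (λ i → d i * f i)))
        (sum-cong-≋ λ i → sym (T.distribʳ (f i) (c i) (d i))))

    *-closed : ∀ a {x} → InIdeal x → InIdeal (a * x)
    *-closed a (c , p) = (λ i → a * c i) ,
      trans (T.*-congˡ p) (trans (*-distribˡ-sum a (λ i → c i * f i))
        (sum-cong-≋ λ i → sym (T.*-assoc a (c i) (f i))))

    resp : ∀ {x y} → x ≈ y → InIdeal y → InIdeal x
    resp e (c , p) = c , trans e p

    0∈ : InIdeal 0#
    0∈ = resp (sym (T.zeroˡ _)) (*-closed 0# {sum (λ i → 0# * f i)} ((λ _ → 0#) , refl))

    -closed : ∀ {x} → InIdeal x → InIdeal (- x)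
    -closed {x} p = resp (sym (T′.-1*x≈-x x)) (*-closed (- 1#) p)

    to : ∀ {x y} → x ≡ᴵ y → ∃ λ e → InIdeal e × x ≈ y + e
    to {x} {y} (congruent p) = x - y , p ,
      sym (trans (T.+-congˡ (T.+-comm x (- y)))
        (trans (sym (T.+-assoc y (- y) x))
        (trans (T.+-congʳ (T.-‿inverseʳ y)) (T.+-identityˡ x))))

    from : ∀ {x y e} → InIdeal e → x ≈ y + e → x ≡ᴵ y
    from {x} {y} {e} p q = congruent (resp
      (trans (T.+-congʳ q) (trans (T.+-congʳ (T.+-comm y e))
        (trans (T.+-assoc e y (- y)) (trans (T.+-congˡ (T.-‿inverseʳ y)) (T.+-identityʳ e))))) p)

    ≈⇒≡ᴵ : ∀ {x y} → x ≈ y → x ≡ᴵ y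
    ≈⇒≡ᴵ e = from 0∈ (trans e (sym (T.+-identityʳ _)))

    neg-cong : ∀ {x y} → x ≡ᴵ y → (- x) ≡ᴵ (- y)
    neg-cong {x} {y} p with to p
    ... | e , e∈ , q = from (-closed e∈) (trans (T.-‿cong q) (sym (G.⁻¹-∙-comm y e)))

    ≡ᴵ-sym : ∀ {x y} → x ≡ᴵ y → y ≡ᴵ x
    ≡ᴵ-sym {x} {y} (congruent p) = congruent (resp
      (sym (trans (sym (G.⁻¹-∙-comm x (- y)))
        (trans (T.+-congˡ (G.⁻¹-involutive y)) (T.+-comm (- x) y)))) (-closed p))

    ≡ᴵ-trans : ∀ {x y z} → x ≡ᴵ y → y ≡ᴵ z → x ≡ᴵ z
    ≡ᴵ-trans p q with to p | to q
    ... | e , e∈ , p′ | g , g∈ , q′ =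
      from (+-closed g∈ e∈) (trans p′ (trans (T.+-congʳ q′) (T.+-assoc _ g e)))

    add-cong : ∀ {x y u v} → x ≡ᴵ y → u ≡ᴵ v → (x + u) ≡ᴵ (y + v)
    add-cong {y = y} {v = v} p q with to p | to q
    ... | e , e∈ , p′ | g , g∈ , q′ =
      from (+-closed e∈ g∈) (trans (T.+-cong p′ q′) (solve 4 (λ y e v g →
        (y :+ e) :+ (v :+ g) := (y :+ v) :+ (e :+ g)) refl y e v g))

    mul-cong : ∀ {x y u v} → x ≡ᴵ y → u ≡ᴵ v → (x * u) ≡ᴵ (y * v)
    mul-cong {y = y} {v = v} p q with to p | to q
    ... | e , e∈ , p′ | g , g∈ , q′ =
      from (+-closed (*-closed y g∈) (*-closed (v + g) e∈))
        (trans (T.*-cong p′ q′) (solve 4 (λ y e v g →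
          (y :+ e) :* (v :+ g) := y :* v :+ (y :* g :+ (v :+ g) :* e)) refl y e v g))

  quotientRing : CommutativeRing 0ℓ 0ℓ
  quotientRing = record
    { Carrier = T.Carrier ; _≈_ = _≡ᴵ_ ; _+_ = _+_ ; _*_ = _*_ ; -_ = -_ ; 0# = 0# ; 1# = 1#
    ; isCommutativeRing = record
      { isRing = record
        { +-isAbelianGroup = record
          { isGroup = record
            { isMonoid = record
              { isSemigroup = record
                { isMagma = record
                  { isEquivalence = record
                    { refl = ≈⇒≡ᴵ refl ; sym = ≡ᴵ-sym ; trans = ≡ᴵ-trans }
                  ; ∙-cong = add-cong }
                ; assoc = λ x y z → ≈⇒≡ᴵ (T.+-assoc x y z) }
              ; identity = (λ x → ≈⇒≡ᴵ (T.+-identityˡ x)) , λ x → ≈⇒≡ᴵ (T.+-identityʳ x) }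
            ; inverse = (λ x → ≈⇒≡ᴵ (T.-‿inverseˡ x)) , λ x → ≈⇒≡ᴵ (T.-‿inverseʳ x)
            ; ⁻¹-cong = neg-cong }
          ; comm = λ x y → ≈⇒≡ᴵ (T.+-comm x y) }
        ; *-cong = mul-cong
        ; *-assoc = λ x y z → ≈⇒≡ᴵ (T.*-assoc x y z)
        ; *-identity = (λ x → ≈⇒≡ᴵ (T.*-identityˡ x)) , λ x → ≈⇒≡ᴵ (T.*-identityʳ x)
        ; distrib = (λ x y z → ≈⇒≡ᴵ (T.distribˡ x y z)) , λ x y z → ≈⇒≡ᴵ (T.distribʳ x y z)
        }
      ; *-comm = λ x y → ≈⇒≡ᴵ (T.*-comm x y) } }

-- dim_K B = d, for a K-algebra B with structure map ι.

HasDimension : (K B : CommutativeRing 0ℓ 0ℓ) →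
  (CommutativeRing.Carrier K → CommutativeRing.Carrier B) → ℕ → Set
HasDimension K B ι d = ∃ λ (b : Vector B.Carrier d) →
    (∀ x → ∃ λ (c : Vector K.Carrier d) → x B.≈ sum (λ t → ι (c t) B.* b t))
  × (∀ (c : Vector K.Carrier d) → sum (λ t → ι (c t) B.* b t) B.≈ B.0# → ∀ t → c t K.≈ K.0#)
  where
  module K = CommutativeRing K
  module B = CommutativeRing B
  open RawSemiringDefinitions (rawSemiringOf B) using (sum)

module Complex (ℝ : CompleteOrderedField) where
  private
    module ℝ = CompleteOrderedField ℝ
    module ℝ′ = RingProperties ℝ.ring
    module O = IsStrictTotalOrder ℝ.isStrictTotalOrder
  open ℝ using (_≈_; _+_; _*_; -_; _-_; 0#; 1#; _<_; _≤_; refl; sym; trans)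
  open SemiringSolver ℝ.commutativeSemiring using (solve; _:=_; _:+_; _:*_) renaming (con to κ)

  infix 9 _+i_

  record ℂ : Set where
    constructor _+i_
    field
      Re Im : ℝ.Carrier

  open ℂ public

  infix 4 _≈ᶜ_

  _≈ᶜ_ : Rel ℂ 0ℓ
  z ≈ᶜ w = Re z ≈ Re w × Im z ≈ Im w

  private
    _⊕_ _⊗_ : ℂ → ℂ → ℂ
    z ⊕ w = (Re z + Re w) +i (Im z + Im w)
    z ⊗ w = (Re z * Re w - Im z * Im w) +i (Re z * Im w + Im z * Re w)

    j : ℝ.Carrier
    j = - 1#

    minus : ∀ x y → x - y ≈ x + j * y
    minus x y = ℝ.+-congˡ (sym (ℝ′.-1*x≈-x y))

    ⊗-comm : ∀ z w → (z ⊗ w) ≈ᶜ (w ⊗ z)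
    ⊗-comm (a +i b) (c +i d) =
        ℝ.+-cong (ℝ.*-comm a c) (ℝ.-‿cong (ℝ.*-comm b d))
      , trans (ℝ.+-comm _ _) (ℝ.+-cong (ℝ.*-comm b c) (ℝ.*-comm a d))

    ⊗-assoc : ∀ z w v → ((z ⊗ w) ⊗ v) ≈ᶜ (z ⊗ (w ⊗ v))
    ⊗-assoc (a +i b) (c +i d) (e +i f) =
        trans (minus _ _) (trans (ℝ.+-congʳ (ℝ.*-congʳ (minus _ _)))
        (trans (solve 7 (λ j a b c d e f →
            (a :* c :+ j :* (b :* d)) :* e :+ j :* ((a :* d :+ b :* c) :* f)
            := a :* (c :* e :+ j :* (d :* f)) :+ j :* (b :* (c :* f :+ d :* e)))
            refl j a b c d e f)
        (sym (trans (minus _ _) (ℝ.+-congʳ (ℝ.*-congˡ (minus _ _)))))))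
      , trans (ℝ.+-congʳ (ℝ.*-congʳ (minus _ _)))
        (trans (solve 7 (λ j a b c d e f →
            (a :* c :+ j :* (b :* d)) :* f :+ (a :* d :+ b :* c) :* e
            := a :* (c :* f :+ d :* e) :+ b :* (c :* e :+ j :* (d :* f)))
            refl j a b c d e f)
        (sym (ℝ.+-congˡ (ℝ.*-congˡ (minus _ _)))))

    ⊗-identityʳ : ∀ z → (z ⊗ (1# +i 0#)) ≈ᶜ z
    ⊗-identityʳ (a +i b) =
        trans (minus _ _) (solve 3 (λ j a b → a :* κ 1 :+ j :* (b :* κ 0) := a) refl j a b)
      , solve 2 (λ a b → a :* κ 0 :+ b :* κ 1 := b) refl a b

    ⊗-distribˡ : ∀ z w v → (z ⊗ (w ⊕ v)) ≈ᶜ ((z ⊗ w) ⊕ (z ⊗ v))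
    ⊗-distribˡ (a +i b) (c +i d) (e +i f) =
        trans (minus _ _)
        (trans (solve 7 (λ j a b c d e f →
            a :* (c :+ e) :+ j :* (b :* (d :+ f))
            := (a :* c :+ j :* (b :* d)) :+ (a :* e :+ j :* (b :* f)))
            refl j a b c d e f)
        (sym (ℝ.+-cong (minus _ _) (minus _ _))))
      , solve 6 (λ a b c d e f →
            a :* (d :+ f) :+ b :* (c :+ e) := (a :* d :+ b :* c) :+ (a :* f :+ b :* e))
            refl a b c d e f

    ⊗-cong : ∀ {z z′ w w′} → z ≈ᶜ z′ → w ≈ᶜ w′ → (z ⊗ w) ≈ᶜ (z′ ⊗ w′)
    ⊗-cong (p , q) (r , s) =
        ℝ.+-cong (ℝ.*-cong p r) (ℝ.-‿cong (ℝ.*-cong q s))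
      , ℝ.+-cong (ℝ.*-cong p s) (ℝ.*-cong q r)

    ⊕-cong : ∀ {z z′ w w′} → z ≈ᶜ z′ → w ≈ᶜ w′ → (z ⊕ w) ≈ᶜ (z′ ⊕ w′)
    ⊕-cong (p , q) (r , s) = ℝ.+-cong p r , ℝ.+-cong q s

    ≈ᶜ-trans : ∀ {z w v} → z ≈ᶜ w → w ≈ᶜ v → z ≈ᶜ v
    ≈ᶜ-trans (p , q) (r , s) = trans p r , trans q s

  complexField : CommutativeRing 0ℓ 0ℓ
  complexField = record
    { Carrier = ℂ ; _≈_ = _≈ᶜ_ ; _+_ = _⊕_ ; _*_ = _⊗_
    ; -_ = λ z → (- Re z) +i (- Im z) ; 0# = 0# +i 0# ; 1# = 1# +i 0#
    ; isCommutativeRing = record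
      { isRing = record
        { +-isAbelianGroup = record
          { isGroup = record
            { isMonoid = record
              { isSemigroup = record
                { isMagma = record
                  { isEquivalence = record
                    { refl = refl , refl ; sym = λ (p , q) → sym p , sym q ; trans = ≈ᶜ-trans }
                  ; ∙-cong = ⊕-cong }
                ; assoc = λ _ _ _ → ℝ.+-assoc _ _ _ , ℝ.+-assoc _ _ _ }
              ; identity = (λ _ → ℝ.+-identityˡ _ , ℝ.+-identityˡ _)
                         , (λ _ → ℝ.+-identityʳ _ , ℝ.+-identityʳ _) }
            ; inverse = (λ _ → ℝ.-‿inverseˡ _ , ℝ.-‿inverseˡ _)
                      , (λ _ → ℝ.-‿inverseʳ _ , ℝ.-‿inverseʳ _)
            ; ⁻¹-cong = λ (p , q) → ℝ.-‿cong p , ℝ.-‿cong q }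
          ; comm = λ _ _ → ℝ.+-comm _ _ , ℝ.+-comm _ _ }
        ; *-cong = ⊗-cong
        ; *-assoc = ⊗-assoc
        ; *-identity = (λ z → ≈ᶜ-trans (⊗-comm _ z) (⊗-identityʳ z)) , ⊗-identityʳ
        ; distrib = ⊗-distribˡ , λ z w v →
            ≈ᶜ-trans (⊗-comm (w ⊕ v) z)
              (≈ᶜ-trans (⊗-distribˡ z w v) (⊕-cong (⊗-comm z w) (⊗-comm z v)))
        }
      ; *-comm = ⊗-comm } }

  private module C = CommutativeRing complexField

  real imaginary : ℝ.Carrier → ℂ
  real x = x +i 0#
  imaginary x = 0# +i x

  normSq : ℂ → ℝ.Carrier
  normSq z = Re z * Re z + Im z * Im z

  private
    <-respʳ : ∀ {x y z} → y ≈ z → x < y → x < z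
    <-respʳ = proj₁ O.<-resp-≈

    <-respˡ : ∀ {x y z} → y ≈ z → y < x → z < x
    <-respˡ = proj₂ O.<-resp-≈

    neg-pos : ∀ {x} → x < 0# → 0# < - x
    neg-pos {x} p = <-respˡ (ℝ.-‿inverseʳ x) (<-respʳ (ℝ.+-identityˡ (- x)) (ℝ.+-monoˡ-< (- x) p))

    square-neg : ∀ x → - x * - x ≈ x * x
    square-neg x = trans (sym (ℝ′.-‿distribˡ-* x (- x)))
      (trans (ℝ.-‿cong (sym (ℝ′.-‿distribʳ-* x x))) (G.⁻¹-involutive (x * x)))
      where module G = AbelianGroupProperties ℝ.+-abelianGroup

    square-pos : ∀ {x} → ¬ (x ≈ 0#) → 0# < x * x
    square-pos {x} x≉0 with O.compare x 0#
    ... | tri< x<0 _ _ = <-respʳ (square-neg x) (ℝ.*-pos (neg-pos x<0) (neg-pos x<0))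
    ... | tri≈ _ x≈0 _ = ⊥-elim (x≉0 x≈0)
    ... | tri> _ _ 0<x = ℝ.*-pos 0<x 0<x

    square-nonneg : ∀ x → 0# ≤ x * x
    square-nonneg x with O.compare x 0#
    ... | tri≈ _ x≈0 _ = inj₂ (sym (trans (ℝ.*-congʳ x≈0) (ℝ.zeroˡ x)))
    ... | tri< _ x≉0 _ = inj₁ (square-pos x≉0)
    ... | tri> _ x≉0 _ = inj₁ (square-pos x≉0)

    +-pos-nonneg : ∀ {x y} → 0# < x → 0# ≤ y → 0# < x + y
    +-pos-nonneg {x} {y} p (inj₁ q) =
      O.trans q (<-respˡ (ℝ.+-identityˡ y) (ℝ.+-monoˡ-< y p))
    +-pos-nonneg {x} {y} p (inj₂ q) =
      <-respʳ (trans (sym (ℝ.+-identityʳ x)) (ℝ.+-congˡ q)) p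

  normSq-nonneg : ∀ z → 0# ≤ normSq z
  normSq-nonneg (a +i b) with square-nonneg a
  ... | inj₁ p = inj₁ (+-pos-nonneg p (square-nonneg b))
  ... | inj₂ p with square-nonneg b
  ...   | inj₁ q = inj₁ (<-respʳ (ℝ.+-comm _ _) (+-pos-nonneg q (inj₂ p)))
  ...   | inj₂ q = inj₂ (trans (sym (ℝ.+-identityʳ 0#)) (ℝ.+-cong p q))

  normSq-pos : ∀ z → ¬ (z C.≈ C.0#) → 0# < normSq z
  normSq-pos (a +i b) z≉0 with O.compare a 0# | O.compare b 0#
  ... | tri< _ a≉0 _ | _            = +-pos-nonneg (square-pos a≉0) (square-nonneg b)
  ... | tri> _ a≉0 _ | _            = +-pos-nonneg (square-pos a≉0) (square-nonneg b)
  ... | tri≈ _ _ _   | tri< _ b≉0 _ =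
    <-respʳ (ℝ.+-comm _ _) (+-pos-nonneg (square-pos b≉0) (square-nonneg a))
  ... | tri≈ _ _ _   | tri> _ b≉0 _ =
    <-respʳ (ℝ.+-comm _ _) (+-pos-nonneg (square-pos b≉0) (square-nonneg a))
  ... | tri≈ _ a≈0 _ | tri≈ _ b≈0 _ = ⊥-elim (z≉0 (a≈0 , b≈0))

  ℂ-integral : ∀ {z w} → ¬ (z C.≈ C.0#) → ¬ (w C.≈ C.0#) → ¬ (z C.* w C.≈ C.0#)
  ℂ-integral {z@(a +i b)} {c +i d} z≉0 w≉0 (re , im) = w≉0 (cancel c≈0 , cancel d≈0)
    where
    N≉0 : ¬ (normSq z ≈ 0#)
    N≉0 N≈0 = O.irrefl (sym N≈0) (normSq-pos z z≉0)

    cancel : ∀ {x} → normSq z * x ≈ 0# → x ≈ 0#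
    cancel {x} e = trans (sym (ℝ.*-identityˡ x))
      (trans (ℝ.*-congʳ (sym (trans (ℝ.*-comm _ _) (ℝ.*-inverseʳ _ N≉0))))
      (trans (ℝ.*-assoc _ _ x) (trans (ℝ.*-congˡ e) (ℝ.zeroʳ _))))

    ac≈bd : a * c ≈ b * d
    ac≈bd = G.x∙y⁻¹≈ε⇒x≈y _ _ re
      where module G = AbelianGroupProperties ℝ.+-abelianGroup

    c≈0 : normSq z * c ≈ 0#
    c≈0 = trans (solve 3 (λ a b c → (a :* a :+ b :* b) :* c := a :* (a :* c) :+ b :* (b :* c)) refl a b c)
      (trans (ℝ.+-congʳ (ℝ.*-congˡ ac≈bd))
      (trans (solve 4 (λ a b c d → a :* (b :* d) :+ b :* (b :* c) := b :* (a :* d :+ b :* c)) refl a b c d)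
      (trans (ℝ.*-congˡ im) (ℝ.zeroʳ b))))

    d≈0 : normSq z * d ≈ 0#
    d≈0 = trans (solve 3 (λ a b d → (a :* a :+ b :* b) :* d := a :* (a :* d) :+ b :* (b :* d)) refl a b d)
      (trans (ℝ.+-congˡ (ℝ.*-congˡ (sym ac≈bd)))
      (trans (solve 4 (λ a b c d → a :* (a :* d) :+ b :* (a :* c) := a :* (a :* d :+ b :* c)) refl a b c d)
      (trans (ℝ.*-congˡ im) (ℝ.zeroʳ a))))

  private
    0<1 : 0# < 1#
    0<1 = <-respʳ (ℝ.*-identityʳ 1#) (square-pos ℝ.1≉0)

    +-monoʳ-< : ∀ {x y} z → x < y → z + x < z + y
    +-monoʳ-< z p = <-respˡ (ℝ.+-comm _ z) (<-respʳ (ℝ.+-comm _ z) (ℝ.+-monoˡ-< z p))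

    diff-pos : ∀ {x y} → x < y → 0# < y - x
    diff-pos {x} p = <-respˡ (ℝ.-‿inverseʳ x) (ℝ.+-monoˡ-< (- x) p)

    x<x*x : ∀ {x} → 1# < x → x < x * x
    x<x*x {x} p = <-respˡ (ℝ.+-identityʳ x) (<-respʳ e
      (+-monoʳ-< x (ℝ.*-pos (O.trans 0<1 p) (diff-pos p))))
      where
      e : x + x * (x - 1#) ≈ x * x
      e = trans (ℝ.+-congˡ (ℝ.*-congˡ (minus x 1#)))
        (trans (solve 2 (λ x j → x :+ x :* (x :+ j :* κ 1) := x :* x :+ x :* (κ 1 :+ j)) refl x j)
        (trans (ℝ.+-congˡ (trans (ℝ.*-congˡ (ℝ.-‿inverseʳ 1#)) (ℝ.zeroʳ x))) (ℝ.+-identityʳ _)))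

    ≤∧<⇒⊥ : ∀ {x y} → x ≤ y → ¬ (y < x)
    ≤∧<⇒⊥ (inj₁ p) q = O.irrefl refl (O.trans p q)
    ≤∧<⇒⊥ (inj₂ p) q = O.irrefl (sym p) q

    sqrt-bound : ∀ {s} → 0# ≤ s → ∀ r → r * r ≤ s → r ≤ 1# + s
    sqrt-bound {s} 0≤s r rr≤s with O.compare r (1# + s)
    ... | tri< p _ _ = inj₁ p
    ... | tri≈ _ p _ = inj₂ p
    ... | tri> _ _ p = ⊥-elim (≤∧<⇒⊥ rr≤s (O.trans (O.trans s<1+s p) (x<x*x (1<r 0≤s))))
      where
      s<1+s : s < 1# + s
      s<1+s = <-respˡ (ℝ.+-identityˡ s) (ℝ.+-monoˡ-< s 0<1)

      1<r : 0# ≤ s → 1# < r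
      1<r (inj₁ q) = O.trans (<-respˡ (ℝ.+-identityʳ 1#) (+-monoʳ-< 1# q)) p
      1<r (inj₂ q) = <-respˡ (trans (ℝ.+-congˡ (sym q)) (ℝ.+-identityʳ 1#)) p

  -- √s = sup {x : x² ≤ s}

  sqrt-supremum : ∀ s → 0# ≤ s → ∃ λ r →
    ℝ.UpperBound (λ x → x * x ≤ s) r × (∀ b → ℝ.UpperBound (λ x → x * x ≤ s) b → r ≤ b)
  sqrt-supremum s 0≤s =
    ℝ.complete (λ x → x * x ≤ s) (0# , zero∈ 0≤s) (1# + s , sqrt-bound 0≤s)
    where
    zero∈ : 0# ≤ s → 0# * 0# ≤ s
    zero∈ (inj₁ p) = inj₁ (<-respˡ (sym (ℝ.zeroˡ 0#)) p)
    zero∈ (inj₂ p) = inj₂ (trans (ℝ.zeroˡ 0#) p)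

  sqrt : ∀ s → 0# ≤ s → ℝ.Carrier
  sqrt s 0≤s = proj₁ (sqrt-supremum s 0≤s)

  ∣_∣ : ℂ → ℝ.Carrier
  ∣ z ∣ = sqrt (normSq z) (normSq-nonneg z)

  open RawSemiringDefinitions (rawSemiringOf complexField) using (_^_; sum)
  open RawSemiringDefinitions (rawSemiringOf ℝ.commutativeRing) using () renaming (_×_ to _·_)

  Converges : (ℕ → ℂ) → ℂ → Set
  Converges s w = ∀ ε → 0# < ε → ∃ λ N → ∀ M → N ℕ.≤ M → ∣ s M C.- w ∣ < ε

  -- w IsExpOf z  means  w = e^z, i.e. w is the sum of the series Σ_t z^t / t!.

  expPartialSum : ℂ → ℕ → ℂ
  expPartialSum z M = sum {M} (λ t → real (((toℕ t !) · 1#) ℝ.⁻¹) C.* (z ^ toℕ t))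

  infix 4 _IsExpOf_

  _IsExpOf_ : ℂ → ℂ → Set
  w IsExpOf z = Converges (expPartialSum z) w

module Tensors (ℝ : CompleteOrderedField) where
  open Complex ℝ public
  open CommutativeRing complexField public
    using (_≈_; _*_; 0#; 1#)
  open RawSemiringDefinitions (rawSemiringOf complexField) public using (_^_) renaming (_×_ to _·_)
  open Polynomials complexField public

  infix 4 _≉_ _∼_

  _≉_ : Rel ℂ 0ℓ
  z ≉ w = ¬ (z ≈ w)

  Tensor : ℕ → ℕ → Set
  Tensor k n = Vec (Fin n) k → ℂ

  Symmetric : ∀ {k n} → Tensor k n → Set
  Symmetric {k} 𝒜 = ∀ (π : Permutation′ k) v → 𝒜 (tabulate (λ t → lookup v (π ⟨$⟩ʳ t))) ≈ 𝒜 v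

  AllEqual : ∀ {k n} → Vec (Fin n) k → Set
  AllEqual = AllPairs _≡_

  Arc : ∀ {r n} → Tensor (suc r) n → Rel (Fin n) 0ℓ
  Arc 𝒜 i j = ∃ λ v → 𝒜 (i ∷ v) ≉ 0# × j ∈ v

  WeaklyIrreducible : ∀ {r n} → Tensor (suc r) n → Set
  WeaklyIrreducible 𝒜 = ∀ i j → Star (Arc 𝒜) i j

  -- Forms Σ_v b_v x_{v₁}⋯x_{v_d}, with x in an arbitrary ℂ-algebra T with
  -- structure map ι, so that the same formula yields values and polynomials.

  module _ (T : CommutativeRing 0ℓ 0ℓ) (ι : ℂ → CommutativeRing.Carrier T) where
    private module T = CommutativeRing T
    open RawSemiringDefinitions (rawSemiringOf T) using (sum; product)

    Σ-indices : ∀ d {n} → (Vec (Fin n) d → T.Carrier) → T.Carrier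
    Σ-indices zero    g = g []
    Σ-indices (suc d) g = sum (λ i → Σ-indices d (λ v → g (i ∷ v)))

    monomial : ∀ {d n} → Vec (Fin n) d → (Fin n → T.Carrier) → T.Carrier
    monomial v x = product (λ t → x (lookup v t))

    form : ∀ {d n} → Tensor d n → (Fin n → T.Carrier) → T.Carrier
    form {d} b x = Σ-indices d (λ v → ι (b v) T.* monomial v x)

    -- The i-th entry of 𝒜x^{k-1}, where k = suc r.

    contract : ∀ {r n} → Tensor (suc r) n → (Fin n → T.Carrier) → Fin n → T.Carrier
    contract 𝒜 x i = form (λ v → 𝒜 (i ∷ v)) x

  EigenEquation : ∀ {r n} → Tensor (suc r) n → ℂ → (Fin n → ℂ) → Set
  EigenEquation {r} 𝒜 μ x = ∀ i → contract complexField id 𝒜 x i ≈ μ * (x i ^ r)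

  Nonzero : ∀ {n} → (Fin n → ℂ) → Set
  Nonzero x = ¬ (∀ i → x i ≈ 0#)

  IsEigenvalue : ∀ {r n} → Tensor (suc r) n → ℂ → Set
  IsEigenvalue 𝒜 μ = ∃ λ x → Nonzero x × EigenEquation 𝒜 μ x

  -- Points of projective space with n homogeneous coordinates, as
  -- representative vectors, and equality of points.

  record ℙ (n : ℕ) : Set where
    constructor point
    field
      coord   : Fin n → ℂ
      nonzero : Nonzero coord

  open ℙ public

  _∼_ : ∀ {n} → Rel (ℙ n) 0ℓ
  p ∼ q = ∃ λ c → c ≉ 0# × (∀ i → coord q i ≈ c * coord p i)

  𝕍 : ∀ {r n} → ℂ → Tensor (suc r) n → Pred (ℙ n) 0ℓ
  𝕍 μ 𝒜 p = EigenEquation 𝒜 μ (coord p)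

  -- p is isolated in V for the Zariski topology, whose basic open sets are the
  -- non-vanishing loci of homogeneous polynomials.

  IsolatedIn : ∀ {n} → Pred (ℙ n) 0ℓ → Pred (ℙ n) 0ℓ
  IsolatedIn {n} V p = V p × ∃₂ λ d (b : Tensor d n) →
      form complexField id b (coord p) ≉ 0#
    × (∀ q → V q → form complexField id b (coord q) ≉ 0# → p ∼ q)

  eigenPolynomial : ∀ {r n} → ℂ → Tensor (suc r) n → Fin n → Poly (Fin n)
  eigenPolynomial {r} {n} μ 𝒜 i = con μ P.* (var i P.^ r) P.- contract (polynomialRing (Fin n)) con 𝒜 var i
    where
    module P where
      open CommutativeRing (polynomialRing (Fin n)) public
      open RawSemiringDefinitions (rawSemiringOf (polynomialRing (Fin n))) public using (_^_)

  -- x_j ↦ 1, the remaining variables being renumbered in order.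

  dehomogenize : ∀ {m} → Fin (suc m) → Poly (Fin (suc m)) → Poly (Fin m)
  dehomogenize j = substitute (insertAt var j (con 1#))

  -- S_M, for S = ℂ[x₁,…,x_m] and M the maximal ideal of the point a ∈ ℂ^m.

  module AtPoint {m} (a : Fin m → ℂ) where
    OutsideM : Pred (Poly (Fin m)) 0ℓ
    OutsideM h = eval a h ≉ 0#

    1∉M : OutsideM (con 1#)
    1∉M (e , _) = CompleteOrderedField.1≉0 ℝ e

    open Localization (polynomialRing (Fin m)) OutsideM 1∉M ℂ-integral public

  -- S_M/⟨f₁,…,f_n⟩S_M for M the maximal ideal of a.

  localAlgebra : ∀ {m n} → (Fin m → ℂ) → (Fin n → Poly (Fin m)) → CommutativeRing 0ℓ 0ℓ
  localAlgebra a f = Quotient.quotientRing (AtPoint.localization a) (AtPoint.fromS a ∘ f)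

  -- The local intersection multiplicity at p equals d in every affine chart
  -- containing p; q is the representative of p normalized at j.

  HasMultiplicity : ∀ {r m} → ℂ → Tensor (suc r) (suc m) → ℙ (suc m) → ℕ → Set
  HasMultiplicity μ 𝒜 p d = ∀ j q → p ∼ q → coord q j ≈ 1# →
    let p̃ = removeAt (coord q) j in
    HasDimension complexField
      (localAlgebra p̃ (dehomogenize j ∘ eigenPolynomial μ 𝒜)) (AtPoint.fromS p̃ ∘ con) d

  -- c_e p^e for e = {v₁,…,v_k}, where k = suc r and v₁,…,v_k are distinct.

  edgeTerm : ∀ {r n} → Tensor (suc r) n → ℙ n → Vec (Fin n) (suc r) → ℂ
  edgeTerm {r} 𝒜 p v = ((r !) · 𝒜 v) * monomial complexField id v (coord p)

{-# OPTIONS --safe #-}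

-- In an affine chart at p the multiplicity is 1 as soon as the Jacobian of the
-- dehomogenized equations has trivial kernel.  Write a kernel vector as
-- (zᵢ qᵢ)ᵢ, with q the normalized representative of p: differentiating
-- logarithmically and using F(q) = 0, the kernel equations become
--   Σ_v a_{iv} p^{iv} Σ_t (zᵢ − z_{v_t}) = 0.
-- Diagonal entries contribute nothing, and for the others r! a_{iv} p^{iv} is a
-- positive real times one fixed phase u, so the real and imaginary parts of z
-- are harmonic for positive weights on the arcs of the tensor.  By the maximum
-- principle and weak irreducibility z is constant; it vanishes at the
-- normalized coordinate, hence z = 0.

module Submission where

open import Defs
open import Algebra.Bundles using (CommutativeRing)
import Algebra.Definitions.RawSemiring as RawSemiringDefinitions
open import Algebra.Morphism.Structures using (module RingMorphisms)
import Algebra.Morphism.Construct.Composition as Composition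
import Algebra.Properties.AbelianGroup as AbelianGroupProperties
import Algebra.Properties.Ring as RingProperties
import Algebra.Properties.Semiring.Sum as SemiringSum
import Algebra.Solver.Ring.NaturalCoefficients.Default as SemiringSolver
open import Data.Empty using (⊥-elim)
open import Data.Fin.Base using (Fin; zero; suc; punchIn; punchOut)
open import Data.Fin.Properties using (any?; punchIn-punchOut) renaming (_≟_ to _≟ᶠ_)
open import Data.Nat.Base using (ℕ; zero; suc; NonZero; _!)
open import Data.Nat.Properties using (_!≢0)
open import Data.Product.Base using (∃; ∃₂; _×_; _,_; proj₁; proj₂)
open import Data.Sum.Base using (_⊎_; inj₁; inj₂)
open import Data.Vec.Base using (Vec; []; _∷_; lookup)
open import Data.Vec.Functional using (Vector; insertAt; removeAt)
open import Data.Vec.Functional.Properties using (insertAt-lookup; insertAt-punchIn)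
open import Data.Vec.Membership.Propositional using (_∈_)
open import Data.Vec.Membership.Propositional.Properties using (∈-lookup)
open import Data.Vec.Relation.Unary.All using () renaming (lookup to All-lookup)
open import Data.Vec.Relation.Unary.AllPairs using (_∷_)
open import Data.Vec.Relation.Unary.Any using (index)
open import Data.Vec.Relation.Unary.Any.Properties using (lookup-index)
open import Data.Vec.Relation.Unary.Unique.Propositional using (Unique)
open import Function.Base using (id; _∘_)
open import Level using (0ℓ)
open import Relation.Binary.Construct.Closure.ReflexiveTransitive using (Star; ε; _◅_)
open import Relation.Binary.Core using (Rel)
open import Relation.Binary.Definitions using (tri<; tri≈; tri>)
open import Relation.Binary.PropositionalEquality.Core as ≡ using (_≡_)
open import Relation.Binary.Structures using (IsStrictTotalOrder)
open import Relation.Nullary using (¬_; Dec; yes; no)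
open import Relation.Nullary.Decidable using (¬?; decidable-stable)
open import Relation.Unary using (Pred)

-- Why a trivial kernel forces multiplicity 1: f = f(a) + Σ_l g_l (x_l - a_l) holds exactly, with
-- polynomial coefficients g_l, and not just modulo second-order terms. In the local algebra every
-- f_i is zero, so the differences x_l - a_l solve a homogeneous linear system whose coefficients
-- reduce at p to the Jacobian. Triviality of its kernel lets elimination proceed with pivots that
-- are nonzero at p, hence units, and the differences vanish. Every fraction is then a constant, and
-- constants survive because every f_i vanishes at p.
--
-- Dividing by q_i is possible since p has no zero entries. With r = k - 1, the term λ x_i^r has
-- logarithmic derivative r z_i, so subtracting r z_i F_i(q) = 0 removes λ. What remains contains
-- a_{iv} q^v; multiplying row i by q_i completes this to a product over a whole k-set, to which the
-- phase condition applies. The common factor is then cancelled, so it has to be nonzero: otherwise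
-- all arcs would be loops, against strong connectivity on two vertices. A constant z is an
-- infinitesimal rescaling of p, the direction that the chart removes.

CRing : Set₁
CRing = CommutativeRing 0ℓ 0ℓ

⟨_⟩ : CRing → Set
⟨ R ⟩ = CommutativeRing.Carrier R

IsHom : (R T : CRing) → (⟨ R ⟩ → ⟨ T ⟩) → Set
IsHom R T = RingMorphisms.IsRingHomomorphism
  (CommutativeRing.rawRing R) (CommutativeRing.rawRing T)

module Hom {R T : CRing} {h} (h-hom : IsHom R T h) where
  open RingMorphisms.IsRingHomomorphism h-hom public
    renaming (⟦⟧-cong to cong; +-homo to +-hom; *-homo to *-hom; 0#-homo to 0-hom; 1#-homo to 1-hom; -‿homo to neg-hom)

module _ {R T : CRing} where
  private
    module R = CommutativeRing R
    module T = CommutativeRing T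

  -- Zero and negation come for free: h 0 is an additive idempotent, and additive inverses are
  -- unique.
  isHom : (h : R.Carrier → T.Carrier) →
          (∀ {x y} → x R.≈ y → h x T.≈ h y) →
          (∀ x y → h (x R.+ y) T.≈ h x T.+ h y) →
          (∀ x y → h (x R.* y) T.≈ h x T.* h y) →
          h R.1# T.≈ T.1# → IsHom R T h
  isHom h h-cong h-+ h-* h-1 = record
    { isSemiringHomomorphism = record
      { isNearSemiringHomomorphism = record
        { +-isMonoidHomomorphism = record
          { isMagmaHomomorphism = record
            { isRelHomomorphism = record { cong = h-cong }
            ; homo = h-+ }
          ; ε-homo = h-0 }
        ; *-homo = h-* }
      ; 1#-homo = h-1 }
    ; -‿homo = λ x → G.inverseʳ-unique (h x) (h (R.- x))
        (T.trans (T.sym (h-+ x (R.- x))) (T.trans (h-cong (R.-‿inverseʳ x)) h-0)) }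
    where
    module G = AbelianGroupProperties T.+-abelianGroup
    module T′ = RingProperties T.ring
    h-0 : h R.0# T.≈ T.0#
    h-0 = T′.x+x≈x⇒x≈0 (h R.0#)
      (T.trans (T.sym (h-+ R.0# R.0#)) (h-cong (R.+-identityˡ R.0#)))

-- Finite sums, linear forms and one step of row reduction

module Sums (R : CRing) where
  open CommutativeRing R hiding (zero)
  open SemiringSum semiring public
  private module R′ = RingProperties ring
  private module G = AbelianGroupProperties +-abelianGroup
  open SemiringSolver commutativeSemiring using (solve; _:=_; _:+_; _:*_)

  sum-zero : ∀ {n} (f : Vector Carrier n) → (∀ i → f i ≈ 0#) → sum f ≈ 0#
  sum-zero {n} f e = trans (sum-cong-≋ e) (sum-replicate-zero n)

  sum-neg : ∀ {n} (f : Vector Carrier n) → sum (λ i → - f i) ≈ - sum f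
  sum-neg {zero}  f = sym G.ε⁻¹≈ε
  sum-neg {suc n} f = trans (+-congˡ (sum-neg (f ∘ suc))) (G.⁻¹-∙-comm _ _)

  sum-minus : ∀ {n} (f g : Vector Carrier n) → sum (λ i → f i - g i) ≈ sum f - sum g
  sum-minus f g = trans (∑-distrib-+ f (λ i → - g i)) (+-congˡ (sum-neg g))

  δ : ∀ {n} → Fin n → Fin n → Carrier
  δ zero    zero    = 1#
  δ zero    (suc _) = 0#
  δ (suc _) zero    = 0#
  δ (suc i) (suc j) = δ i j

  sum-δ : ∀ {n} (i : Fin n) (f : Vector Carrier n) → sum (λ l → δ i l * f l) ≈ f i
  sum-δ zero f = trans (+-cong (*-identityˡ _) (sum-zero (λ l → 0# * f (suc l)) λ l → zeroˡ _)) (+-identityʳ _)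
  sum-δ (suc i) f = trans (+-cong (zeroˡ _) (sum-δ i (f ∘ suc))) (+-identityˡ _)

  infix 7 _∙_

  _∙_ : ∀ {n} → Vector Carrier n → Vector Carrier n → Carrier
  a ∙ x = sum (λ l → a l * x l)

  ∙-congˡ : ∀ {n} {a b x : Vector Carrier n} → (∀ l → a l ≈ b l) → a ∙ x ≈ b ∙ x
  ∙-congˡ e = sum-cong-≋ λ l → *-congʳ (e l)

  ∙-combine : ∀ {n} c d (a b x : Vector Carrier n) →
    (λ l → c * a l + d * b l) ∙ x ≈ c * (a ∙ x) + d * (b ∙ x)
  ∙-combine c d a b x = trans
    (sum-cong-≋ λ l → solve 5 (λ c d a b x → (c :* a :+ d :* b) :* x := c :* (a :* x) :+ d :* (b :* x))
      refl c d (a l) (b l) (x l))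
    (trans (∑-distrib-+ (λ l → c * (a l * x l)) (λ l → d * (b l * x l)))
      (sym (+-cong (*-distribˡ-sum c (λ l → a l * x l)) (*-distribˡ-sum d (λ l → b l * x l)))))

  -- Division-free elimination: b₀ a - a₀ b without its first entry, which cancels. Since the pivot
  -- b₀ is not inverted, the formula makes sense in any commutative ring and commutes with
  -- homomorphisms.
  reducedRow : ∀ {n} → Vector Carrier (suc n) → Vector Carrier (suc n) → Vector Carrier n
  reducedRow b a l = b zero * a (suc l) + (- a zero) * b (suc l)

  -- The pivot row is b.
  reducedRow-zero : ∀ {n} (a b x : Vector Carrier (suc n)) →
    b ∙ x ≈ 0# → a ∙ x ≈ 0# → reducedRow b a ∙ (x ∘ suc) ≈ 0#
  reducedRow-zero a b x bx ax = begin
    reducedRow b a ∙ (x ∘ suc)      ≈⟨ ∙-combine b₀ (- a₀) (a ∘ suc) (b ∘ suc) (x ∘ suc) ⟩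
    b₀ * A + (- a₀) * B             ≈⟨ +-identityʳ _ ⟨
    b₀ * A + (- a₀) * B + 0#        ≈⟨ +-congˡ (trans (*-congʳ (*-congʳ (-‿inverseʳ a₀))) (trans (*-congʳ (zeroˡ _)) (zeroˡ _))) ⟨
    b₀ * A + (- a₀) * B + (a₀ + - a₀) * b₀ * x₀
      ≈⟨ solve 6 (λ a₀ j b₀ x₀ A B → b₀ :* A :+ j :* B :+ (a₀ :+ j) :* b₀ :* x₀
           := b₀ :* (a₀ :* x₀ :+ A) :+ j :* (b₀ :* x₀ :+ B)) refl a₀ (- a₀) b₀ x₀ A B ⟩
    b₀ * (a₀ * x₀ + A) + (- a₀) * (b₀ * x₀ + B) ≈⟨ +-cong (trans (*-congˡ ax) (zeroʳ _)) (trans (*-congˡ bx) (zeroʳ _)) ⟩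
    0# + 0#                         ≈⟨ +-identityʳ _ ⟩
    0# ∎
    where
    open import Relation.Binary.Reasoning.Setoid setoid
    a₀ = a zero
    b₀ = b zero
    x₀ = x zero
    A = (a ∘ suc) ∙ (x ∘ suc)
    B = (b ∘ suc) ∙ (x ∘ suc)

  -- A solution y of the reduced system, multiplied by the pivot b₀ so that the first coordinate can
  -- be solved for without division.
  backSubstitute : ∀ {n} → Vector Carrier (suc n) → Vector Carrier n → Vector Carrier (suc n)
  backSubstitute b y zero    = - ((b ∘ suc) ∙ y)
  backSubstitute b y (suc l) = b zero * y l

  backSubstitute-zero : ∀ {n} (a b : Vector Carrier (suc n)) y →
    reducedRow b a ∙ y ≈ 0# → a ∙ backSubstitute b y ≈ 0#
  backSubstitute-zero a b y e = begin
    a₀ * - B + sum (λ l → a (suc l) * (b₀ * y l))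
      ≈⟨ +-cong (trans (sym (R′.-‿distribʳ-* a₀ B)) (R′.-‿distribˡ-* a₀ B))
           (trans (sum-cong-≋ λ l → solve 3 (λ a b y → a :* (b :* y) := b :* (a :* y)) refl (a (suc l)) b₀ (y l))
                  (sym (*-distribˡ-sum b₀ (λ l → a (suc l) * y l)))) ⟩
    (- a₀) * B + b₀ * A          ≈⟨ +-comm _ _ ⟩
    b₀ * A + (- a₀) * B          ≈⟨ ∙-combine b₀ (- a₀) (a ∘ suc) (b ∘ suc) y ⟨
    reducedRow b a ∙ y           ≈⟨ e ⟩
    0# ∎
    where
    open import Relation.Binary.Reasoning.Setoid setoid
    a₀ = a zero
    b₀ = b zero
    A = (a ∘ suc) ∙ y
    B = (b ∘ suc) ∙ y

-- Fields with a zero test, and elimination over a local ring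

record DiscreteField : Set₁ where
  field
    commutativeRing : CRing
  open CommutativeRing commutativeRing public
  field
    1≉0          : ¬ (1# ≈ 0#)
    ≈0?          : ∀ x → Dec (x ≈ 0#)
    reciprocal   : Carrier → Carrier
    *-reciprocal : ∀ x → ¬ (x ≈ 0#) → x * reciprocal x ≈ 1#
    integral     : ∀ {x y} → ¬ (x ≈ 0#) → ¬ (y ≈ 0#) → ¬ (x * y ≈ 0#)

-- Gaussian elimination over S, with pivots that are nonzero in the residue
-- field 𝕂 and hence cancellable in the local ring Q; this replaces Nakayama's
-- lemma.
module Elimination
  (S : CRing) (𝕂 : DiscreteField) (Q : CRing)
  (ev : ⟨ S ⟩ → DiscreteField.Carrier 𝕂) (φ : ⟨ S ⟩ → ⟨ Q ⟩)
  where
  private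
    K : CRing
    K = DiscreteField.commutativeRing 𝕂
    module S = CommutativeRing S
    module K = DiscreteField 𝕂
    module Q = CommutativeRing Q
    module SS = Sums S
    module KS = Sums K
    module QS = Sums Q

  reducedRow-hom : ∀ (T : CRing) {h} → IsHom S T h → ∀ {m} (b a : Vector S.Carrier (suc m)) l →
    CommutativeRing._≈_ T (h (SS.reducedRow b a l)) (Sums.reducedRow T (h ∘ b) (h ∘ a) l)
  reducedRow-hom T hom b a l = trans (+-hom _ _) (+-cong (*-hom _ _) (trans (*-hom _ _) (*-congʳ (neg-hom _))))
    where
    open Hom {S} {T} hom
    open CommutativeRing T hiding (zero)

  -- Induction on the number of unknowns. The first column has a pivot, since otherwise the first
  -- basis vector would lie in the residue kernel. The reduced system keeps a trivial residue
  -- kernel, which kills the later unknowns; the pivot row then reads `φ (A i₀ zero) * ξ zero = 0`,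
  -- and the pivot cancels.
  trivialKernel⇒zero : IsHom S K ev → IsHom S Q φ →
    (∀ s {q} → ¬ (ev s K.≈ K.0#) → φ s Q.* q Q.≈ Q.0# → q Q.≈ Q.0#) → ∀ {n} m (A : Fin n → Vector S.Carrier m) →
    (∀ y → (∀ i → (ev ∘ A i) KS.∙ y K.≈ K.0#) → ∀ l → y l K.≈ K.0#) →
    (ξ : Vector Q.Carrier m) → (∀ i → (φ ∘ A i) QS.∙ ξ Q.≈ Q.0#) → ∀ l → ξ l Q.≈ Q.0#
  trivialKernel⇒zero _ _ _ zero A _ ξ _ ()
  trivialKernel⇒zero ev-hom φ-hom cancel {n} (suc m) A kernel ξ Aξ with any? (λ i → ¬? (K.≈0? (ev (A i zero))))
  ... | no all0 = ⊥-elim (K.1≉0 (kernel (KS.δ zero) e zero))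
    where
    e : ∀ i → (ev ∘ A i) KS.∙ KS.δ zero K.≈ K.0#
    e i = K.trans (K.+-cong (K.trans (K.*-identityʳ _) (decidable-stable (K.≈0? _) λ ≉0 → all0 (i , ≉0)))
                            (KS.sum-zero (λ l → ev (A i (suc l)) K.* K.0#) λ l → K.zeroʳ _))
                  (K.+-identityʳ _)
  ... | yes (i₀ , pivot) = λ { zero → ξ₀ ; (suc l) → ξ₊ l }
    where
    A′ : Fin n → Vector S.Carrier m
    A′ i = SS.reducedRow (A i₀) (A i)

    kernel′ : ∀ y → (∀ i → (ev ∘ A′ i) KS.∙ y K.≈ K.0#) → ∀ l → y l K.≈ K.0#
    -- Back-substitution yields pivot times y l = 0. Integrality is stated negatively, so the zero
    -- test turns it into y l = 0.
    kernel′ y e l = decidable-stable (K.≈0? (y l)) λ yl≉0 → K.integral pivot yl≉0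
      (kernel (KS.backSubstitute (ev ∘ A i₀) y)
        (λ i → KS.backSubstitute-zero (ev ∘ A i) (ev ∘ A i₀) y
          (K.trans (KS.∙-congˡ {x = y} λ l → K.sym (reducedRow-hom K ev-hom (A i₀) (A i) l)) (e i)))
        (suc l))

    ξ₊ : ∀ l → ξ (suc l) Q.≈ Q.0#
    ξ₊ = trivialKernel⇒zero ev-hom φ-hom cancel m A′ kernel′ (ξ ∘ suc) λ i →
      Q.trans (QS.∙-congˡ {x = ξ ∘ suc} (reducedRow-hom Q φ-hom (A i₀) (A i)))
        (QS.reducedRow-zero (φ ∘ A i) (φ ∘ A i₀) ξ (Aξ i₀) (Aξ i))

    ξ₀ : ξ zero Q.≈ Q.0#
    ξ₀ = cancel (A i₀ zero) pivot
      (Q.trans (Q.sym (Q.+-identityʳ _))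
        (Q.trans (Q.+-congˡ (Q.sym (QS.sum-zero (λ l → φ (A i₀ (suc l)) Q.* ξ (suc l)) λ l → Q.trans (Q.*-congˡ (ξ₊ l)) (Q.zeroʳ _)))) (Aξ i₀)))

-- Evaluation of polynomials and exact first-order expansion

module Evaluation (R : CRing) where
  open Polynomials R
  private module R = CommutativeRing R

  con-hom : ∀ V → IsHom R (polynomialRing V) con
  con-hom V = isHom {R} {polynomialRing V} con con-cong con-+ con-* ≋-refl

  module _ (T : CRing) {ι} (ι-hom : IsHom R T ι) {V : Set} (x : V → CommutativeRing.Carrier T) where
    open CommutativeRing T
    private module ι = Hom {R} {T} ι-hom

    evalIn-cong : ∀ {f g} → f ≋ g → evalIn T ι x f ≈ evalIn T ι x g
    evalIn-cong ≋-refl               = refl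
    evalIn-cong (≋-sym p)            = sym (evalIn-cong p)
    evalIn-cong (≋-trans p q)        = trans (evalIn-cong p) (evalIn-cong q)
    evalIn-cong (⊕-cong p q)         = +-cong (evalIn-cong p) (evalIn-cong q)
    evalIn-cong (⊗-cong p q)         = *-cong (evalIn-cong p) (evalIn-cong q)
    evalIn-cong (⊝-cong p)           = -‿cong (evalIn-cong p)
    evalIn-cong (⊕-assoc f g h)      = +-assoc _ _ _
    evalIn-cong (⊕-comm f g)         = +-comm _ _
    evalIn-cong (⊕-identityʳ f)      = trans (+-congˡ ι.0-hom) (+-identityʳ _)
    evalIn-cong (⊕-inverseʳ f)       = trans (-‿inverseʳ _) (sym ι.0-hom)
    evalIn-cong (⊗-assoc f g h)      = *-assoc _ _ _
    evalIn-cong (⊗-comm f g)         = *-comm _ _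
    evalIn-cong (⊗-identityʳ f)      = trans (*-congˡ ι.1-hom) (*-identityʳ _)
    evalIn-cong (⊗-distribˡ-⊕ f g h) = distribˡ _ _ _
    evalIn-cong (con-cong e)         = ι.cong e
    evalIn-cong (con-+ a b)          = ι.+-hom a b
    evalIn-cong (con-* a b)          = ι.*-hom a b

    evalIn-hom : IsHom (polynomialRing V) T (evalIn T ι x)
    evalIn-hom = isHom {polynomialRing V} {T} (evalIn T ι x) evalIn-cong
      (λ _ _ → refl) (λ _ _ → refl) ι.1-hom

  eval-hom : ∀ {V} (a : V → R.Carrier) → IsHom (polynomialRing V) R (eval a)
  eval-hom a = evalIn-hom R (isHom {R} {R} id id (λ _ _ → R.refl) (λ _ _ → R.refl) R.refl) a

  -- f = f(a) + Σ_l (taylor f l) (x_l − a_l), and taylor f l takes the value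
  -- ∂f/∂x_l (a) at a.

  module Taylor {m} (a : Fin m → R.Carrier) where
    taylor : Poly (Fin m) → Fin m → Poly (Fin m)
    taylor (con _) l = con R.0#
    taylor (var v) l = Sums.δ (polynomialRing (Fin m)) v l
    taylor (f ⊕ g) l = taylor f l ⊕ taylor g l
    -- From fg - f(a)g(a) = (f - f(a)) g + f(a) (g - g(a)). Leaving g unevaluated in the first
    -- summand makes the expansion exact; at a it becomes the Leibniz rule.
    taylor (f ⊗ g) l = taylor f l ⊗ g ⊕ con (eval a f) ⊗ taylor g l
    taylor (⊝ f)   l = ⊝ taylor f l

    module Pairing (T : CRing) {φ} (φ-hom : IsHom (polynomialRing (Fin m)) T φ)
      (w : Vector (CommutativeRing.Carrier T) m) where
      open CommutativeRing T hiding (zero)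
      open Sums T
      open Hom {polynomialRing (Fin m)} {T} φ-hom
      private module T′ = RingProperties ring

      -- Serves twice: with w l = φ(x_l) - φ(a_l) it is the remainder of the expansion in T, and
      -- with φ = `eval a` and w = y it is the derivative at a in the direction y.
      pairing : Poly (Fin m) → Carrier
      pairing f = (φ ∘ taylor f) ∙ w

      pairing-con : ∀ c → pairing (con c) ≈ 0#
      pairing-con c = sum-zero (λ l → φ (con R.0#) * w l) λ l → trans (*-congʳ 0-hom) (zeroˡ _)

      φ-δ : ∀ {n} (i l : Fin n) → φ (Sums.δ (polynomialRing (Fin m)) i l) ≈ δ i l
      φ-δ zero    zero    = 1-hom
      φ-δ zero    (suc _) = 0-hom
      φ-δ (suc _) zero    = 0-hom
      φ-δ (suc i) (suc l) = φ-δ i l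

      pairing-var : ∀ v → pairing (var v) ≈ w v
      pairing-var v = trans (∙-congˡ {x = w} (φ-δ v)) (sum-δ v w)

      pairing-⊕ : ∀ f g → pairing (f ⊕ g) ≈ pairing f + pairing g
      pairing-⊕ f g = trans
        (sum-cong-≋ λ l → trans (*-congʳ (+-hom (taylor f l) (taylor g l))) (distribʳ (w l) (φ (taylor f l)) (φ (taylor g l))))
        (∑-distrib-+ (λ l → φ (taylor f l) * w l) (λ l → φ (taylor g l) * w l))

      pairing-⊗ : ∀ f g → pairing (f ⊗ g) ≈ pairing f * φ g + φ (con (eval a f)) * pairing g
      pairing-⊗ f g = trans
        (∙-congˡ {x = w} λ l → trans (+-hom _ _) (+-cong (trans (*-hom (taylor f l) g) (*-comm _ _)) (*-hom (con (eval a f)) (taylor g l))))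
        (trans (∙-combine (φ g) (φ (con (eval a f))) (φ ∘ taylor f) (φ ∘ taylor g) w)
               (+-congʳ (*-comm _ _)))

      pairing-⊝ : ∀ f → pairing (⊝ f) ≈ - pairing f
      pairing-⊝ f = trans
        (sum-cong-≋ λ l → trans (*-congʳ (neg-hom (taylor f l))) (sym (T′.-‿distribˡ-* (φ (taylor f l)) (w l))))
        (sum-neg (λ l → φ (taylor f l) * w l))

    module _ (T : CRing) {φ} (φ-hom : IsHom (polynomialRing (Fin m)) T φ) where
      open CommutativeRing T hiding (zero)
      open Sums T
      open Hom {polynomialRing (Fin m)} {T} φ-hom
      private
        module G = AbelianGroupProperties +-abelianGroup
        module con = Hom {R} {polynomialRing (Fin m)} (con-hom (Fin m))
      open SemiringSolver commutativeSemiring using (solve; _:=_; _:+_; _:*_)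
      open Pairing T φ-hom (λ l → φ (var l) - φ (con (a l)))

      taylor-expansion : ∀ f → φ f ≈ φ (con (eval a f)) + pairing f
      taylor-expansion (con c) = sym (trans (+-congˡ (pairing-con c)) (+-identityʳ _))
      taylor-expansion (var v) = sym (trans (+-congˡ (pairing-var v))
        (trans (+-comm _ _) (trans (+-assoc _ _ _) (trans (+-congˡ (-‿inverseˡ _)) (+-identityʳ _)))))
      taylor-expansion (f ⊕ g) = trans (+-hom f g) (trans (+-cong (taylor-expansion f) (taylor-expansion g))
        (trans (solve 4 (λ a b c d → (a :+ b) :+ (c :+ d) := (a :+ c) :+ (b :+ d)) refl _ _ _ _)
          (+-cong (sym (trans (cong (con.+-hom _ _)) (+-hom _ _))) (sym (pairing-⊕ f g)))))
      taylor-expansion (f ⊗ g) = begin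
        φ (f ⊗ g)                          ≈⟨ *-hom f g ⟩
        φ f * φ g                          ≈⟨ *-congʳ (taylor-expansion f) ⟩
        (f₀ + pairing f) * φ g             ≈⟨ distribʳ _ _ _ ⟩
        f₀ * φ g + pairing f * φ g         ≈⟨ +-congʳ (*-congˡ (taylor-expansion g)) ⟩
        f₀ * (g₀ + pairing g) + pairing f * φ g
          ≈⟨ solve 4 (λ a b c d → a :* (b :+ c) :+ d := a :* b :+ (d :+ a :* c)) refl _ _ _ _ ⟩
        f₀ * g₀ + (pairing f * φ g + f₀ * pairing g)
          ≈⟨ +-cong (trans (cong (con.*-hom _ _)) (*-hom _ _)) (pairing-⊗ f g) ⟨
        φ (con (eval a (f ⊗ g))) + pairing (f ⊗ g) ∎
        where
        open import Relation.Binary.Reasoning.Setoid setoid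
        f₀ = φ (con (eval a f))
        g₀ = φ (con (eval a g))
      taylor-expansion (⊝ f) = trans (neg-hom f) (trans (-‿cong (taylor-expansion f))
        (trans (sym (G.⁻¹-∙-comm _ _))
          (+-cong (sym (trans (cong (con.neg-hom _)) (neg-hom _))) (sym (pairing-⊝ f)))))

      constant-residues⇒constant : (∀ l → φ (var l) ≈ φ (con (a l))) → ∀ f → φ f ≈ φ (con (eval a f))
      constant-residues⇒constant e f = trans (taylor-expansion f) (trans
        (+-congˡ (sum-zero (λ l → φ (taylor f l) * (φ (var l) - φ (con (a l))))
          λ l → trans (*-congˡ (trans (+-congʳ (e l)) (-‿inverseʳ _))) (zeroʳ _)))
        (+-identityʳ _))

-- The canonical maps to a localization and to a quotient

module LocalizationMap
  (S : CRing) (D : Pred (CommutativeRing.Carrier S) 0ℓ)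
  (1∈D : D (CommutativeRing.1# S))
  (*-closed : ∀ {s t} → D s → D t → D (CommutativeRing._*_ S s t))
  where
  open Localization S D 1∈D *-closed
  private module S = CommutativeRing S
  private module L = CommutativeRing localization
  open SemiringSolver S.commutativeSemiring using (solve; _:=_; _:+_; _:*_) renaming (con to κ)

  fromS-hom : IsHom S localization fromS
  fromS-hom = isHom {S} {localization} fromS
    (λ e → scale S.1# 1∈D (S.*-congˡ (S.*-congʳ e)))
    (λ a b → scale S.1# 1∈D (solve 2 (λ a b → κ 1 :* ((a :+ b) :* (κ 1 :* κ 1))
       := κ 1 :* ((a :* κ 1 :+ b :* κ 1) :* κ 1)) S.refl a b))
    (λ a b → scale S.1# 1∈D (solve 2 (λ a b → κ 1 :* ((a :* b) :* (κ 1 :* κ 1))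
       := κ 1 :* ((a :* b) :* κ 1)) S.refl a b))
    L.refl

  den-clears : ∀ x → fromS (den x) L.* x L.≈ fromS (num x)
  den-clears (a ÷ s [ _ ]) = scale S.1# 1∈D
    (solve 2 (λ a s → κ 1 :* ((s :* a) :* κ 1) := κ 1 :* (a :* (κ 1 :* s))) S.refl a s)

  inverse : ∀ {s} (s∈D : D s) → (S.1# ÷ s [ s∈D ]) L.* fromS s L.≈ L.1#
  inverse {s} s∈D = scale S.1# 1∈D
    (solve 1 (λ s → κ 1 :* ((κ 1 :* s) :* κ 1) := κ 1 :* (κ 1 :* (s :* κ 1))) S.refl s)

module QuotientMap (T : CRing) {s} (f : Vector (CommutativeRing.Carrier T) s) where
  open Quotient T f
  private module T = CommutativeRing T
  private module Q = CommutativeRing quotientRing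
  open Sums T
  private module G = AbelianGroupProperties T.+-abelianGroup

  quotient-cong : ∀ {x y} → x T.≈ y → x Q.≈ y
  quotient-cong e = congruent ((λ _ → T.0#) ,
    T.trans (G.x≈y⇒x∙y⁻¹≈ε e) (T.sym (sum-zero (λ i → T.0# T.* f i) λ i → T.zeroˡ _)))

  quotient-hom : IsHom T quotientRing id
  quotient-hom = isHom {T} {quotientRing} id quotient-cong (λ _ _ → Q.refl) (λ _ _ → Q.refl) Q.refl

  generator-zero : ∀ i → f i Q.≈ Q.0#
  generator-zero i = congruent (δ i ,
    T.trans (T.+-congˡ G.ε⁻¹≈ε) (T.trans (T.+-identityʳ _) (T.sym (sum-δ i f))))

-- Order, positivity and the field of complex numbers

module OrderedField (ℝ : CompleteOrderedField) where
  open CompleteOrderedField ℝ hiding (zero)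
  open Sums commutativeRing
  private module O = IsStrictTotalOrder isStrictTotalOrder
  private module G = AbelianGroupProperties +-abelianGroup

  <-respʳ : ∀ {x y z} → y ≈ z → x < y → x < z
  <-respʳ = proj₁ O.<-resp-≈

  <-respˡ : ∀ {x y z} → y ≈ z → y < x → z < x
  <-respˡ = proj₂ O.<-resp-≈

  ≤-respʳ : ∀ {x y z} → y ≈ z → x ≤ y → x ≤ z
  ≤-respʳ e (inj₁ p) = inj₁ (<-respʳ e p)
  ≤-respʳ e (inj₂ p) = inj₂ (trans p e)

  ≤-trans : ∀ {x y z} → x ≤ y → y ≤ z → x ≤ z
  ≤-trans (inj₁ p) (inj₁ q) = inj₁ (O.trans p q)
  ≤-trans (inj₂ p) (inj₁ q) = inj₁ (<-respˡ (sym p) q)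
  ≤-trans p (inj₂ q) = ≤-respʳ q p

  ≤-total : ∀ x y → x ≤ y ⊎ y ≤ x
  ≤-total x y with O.compare x y
  ... | tri< p _ _ = inj₁ (inj₁ p)
  ... | tri≈ _ p _ = inj₁ (inj₂ p)
  ... | tri> _ _ p = inj₂ (inj₁ p)

  pos⇒≉0 : ∀ {x} → 0# < x → ¬ (x ≈ 0#)
  pos⇒≉0 p e = O.irrefl (sym e) p

  x≤y⇒0≤y-x : ∀ {x y} → x ≤ y → 0# ≤ y - x
  x≤y⇒0≤y-x {x} (inj₁ p) = inj₁ (<-respˡ (-‿inverseʳ x) (+-monoˡ-< (- x) p))
  x≤y⇒0≤y-x (inj₂ p) = inj₂ (sym (G.x≈y⇒x∙y⁻¹≈ε (sym p)))

  +-pos-nonneg : ∀ {x y} → 0# < x → 0# ≤ y → 0# < x + y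
  +-pos-nonneg {x} {y} p (inj₁ q) = O.trans q (<-respˡ (+-identityˡ y) (+-monoˡ-< y p))
  +-pos-nonneg {x} {y} p (inj₂ q) = <-respʳ (trans (sym (+-identityʳ x)) (+-congˡ q)) p

  +-nonneg : ∀ {x y} → 0# ≤ x → 0# ≤ y → 0# ≤ x + y
  +-nonneg (inj₁ p) q = inj₁ (+-pos-nonneg p q)
  +-nonneg {x} {y} (inj₂ p) q = ≤-respʳ (trans (sym (+-identityˡ y)) (+-congʳ p)) q

  *-nonneg : ∀ {x y} → 0# ≤ x → 0# ≤ y → 0# ≤ x * y
  *-nonneg (inj₁ p) (inj₁ q) = inj₁ (*-pos p q)
  *-nonneg (inj₂ p) q = inj₂ (sym (trans (*-congʳ (sym p)) (zeroˡ _)))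
  *-nonneg (inj₁ p) (inj₂ q) = inj₂ (sym (trans (*-congˡ (sym q)) (zeroʳ _)))

  pos*nonneg≈0 : ∀ {x y} → 0# < x → 0# ≤ y → x * y ≈ 0# → y ≈ 0#
  pos*nonneg≈0 p (inj₁ q) e = ⊥-elim (pos⇒≉0 (*-pos p q) e)
  pos*nonneg≈0 p (inj₂ q) e = sym q

  nonneg+nonneg≈0 : ∀ {x y} → 0# ≤ x → 0# ≤ y → x + y ≈ 0# → x ≈ 0#
  nonneg+nonneg≈0 (inj₁ p) q e = ⊥-elim (pos⇒≉0 (+-pos-nonneg p q) e)
  nonneg+nonneg≈0 (inj₂ p) q e = sym p

  sum-nonneg : ∀ {n} (f : Vector Carrier n) → (∀ i → 0# ≤ f i) → 0# ≤ sum f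
  sum-nonneg {zero}  f p = inj₂ refl
  sum-nonneg {suc n} f p = +-nonneg (p zero) (sum-nonneg (f ∘ suc) (p ∘ suc))

  sum≈0 : ∀ {n} (f : Vector Carrier n) → (∀ i → 0# ≤ f i) → sum f ≈ 0# → ∀ i → f i ≈ 0#
  sum≈0 {suc n} f p e zero    = nonneg+nonneg≈0 (p zero) (sum-nonneg (f ∘ suc) (p ∘ suc)) e
  sum≈0 {suc n} f p e (suc i) = sum≈0 (f ∘ suc) (p ∘ suc)
    (nonneg+nonneg≈0 (sum-nonneg (f ∘ suc) (p ∘ suc)) (p zero) (trans (+-comm _ _) e)) i

  argmax : ∀ {n} (f : Vector Carrier (suc n)) → ∃ λ i → ∀ j → f j ≤ f i
  argmax {zero}  f = zero , λ { zero → inj₂ refl }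
  argmax {suc n} f with argmax (f ∘ suc)
  ... | i , max with ≤-total (f zero) (f (suc i))
  ...   | inj₁ p = suc i , λ { zero → p ; (suc j) → max j }
  ...   | inj₂ p = zero , λ { zero → inj₂ refl ; (suc j) → ≤-trans (max j) p }

  0<1 : 0# < 1#
  0<1 with O.compare 0# 1#
  ... | tri< p _ _ = p
  ... | tri≈ _ p _ = ⊥-elim (1≉0 (sym p))
  ... | tri> _ _ p = <-respʳ (trans (sym (-‿distribˡ-* 1# (- 1#))) (trans (-‿cong (*-identityˡ _)) (G.⁻¹-involutive 1#)))
                       (*-pos 0<-1 0<-1)
    where
    open RingProperties ring
    0<-1 : 0# < - 1#
    0<-1 = <-respˡ (-‿inverseʳ 1#) (<-respʳ (+-identityˡ _) (+-monoˡ-< (- 1#) p))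

  ×1-pos : ∀ n → 0# < RawSemiringDefinitions._×_ (rawSemiringOf commutativeRing) (suc n) 1#
  ×1-pos zero    = <-respʳ (sym (+-identityʳ 1#)) 0<1
  ×1-pos (suc n) = +-pos-nonneg 0<1 (inj₁ (×1-pos n))

module ComplexFacts (ℝ : CompleteOrderedField) where
  open Tensors ℝ
  open OrderedField ℝ
  private
    module ℝ = CompleteOrderedField ℝ
    module ℝ′ = RingProperties ℝ.ring
    module G = AbelianGroupProperties ℝ.+-abelianGroup
    module O = IsStrictTotalOrder ℝ.isStrictTotalOrder
    module C = CommutativeRing complexField
  open SemiringSolver ℝ.commutativeSemiring using (solve; _:=_; _:+_; _:*_)

  -- Trichotomy of the order decides equality of reals, hence of real and imaginary parts.
  ≈0? : ∀ z → Dec (z ≈ 0#)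
  ≈0? (a +i b) with a O.≟ ℝ.0# | b O.≟ ℝ.0#
  ... | yes p | yes q = yes (p , q)
  ... | no p  | _     = no λ e → p (proj₁ e)
  ... | yes _ | no q  = no λ e → q (proj₂ e)

  1≉0 : 1# ≉ 0#
  1≉0 e = ℝ.1≉0 (proj₁ e)

  cancelˡ : ∀ {z w} → z ≉ 0# → z * w ≈ 0# → w ≈ 0#
  cancelˡ {z} {w} z≉0 e = decidable-stable (≈0? w) λ w≉0 → ℂ-integral z≉0 w≉0 e

  cancelˡ-≈ : ∀ {z x y} → z ≉ 0# → z * x ≈ z * y → x ≈ y
  cancelˡ-≈ {z} {x} {y} z≉0 e = GC.x∙y⁻¹≈ε⇒x≈y x y (cancelˡ z≉0
    (C.trans (C′.x[y-z]≈xy-xz z x y) (GC.x≈y⇒x∙y⁻¹≈ε e)))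
    where
    module GC = AbelianGroupProperties C.+-abelianGroup
    module C′ = RingProperties C.ring

  reciprocal : ℂ → ℂ
  reciprocal z = (Re z ℝ.* normSq z ℝ.⁻¹) +i (ℝ.- (Im z ℝ.* normSq z ℝ.⁻¹))

  *-reciprocal : ∀ z → z ≉ 0# → z * reciprocal z ≈ 1#
  *-reciprocal z@(a +i b) z≉0 =
      ℝ.trans (ℝ.+-congˡ (ℝ.trans (ℝ.-‿cong (ℝ.sym (ℝ′.-‿distribʳ-* b _))) (G.⁻¹-involutive _)))
        (ℝ.trans (solve 3 (λ a b n → a :* (a :* n) :+ b :* (b :* n) := (a :* a :+ b :* b) :* n) ℝ.refl a b (normSq z ℝ.⁻¹))
          (ℝ.*-inverseʳ _ (pos⇒≉0 (normSq-pos z z≉0))))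
    , ℝ.trans (ℝ.+-congʳ (ℝ.sym (ℝ′.-‿distribʳ-* a _)))
        (ℝ.trans (ℝ.+-congˡ (solve 3 (λ a b n → b :* (a :* n) := a :* (b :* n)) ℝ.refl a b (normSq z ℝ.⁻¹)))
          (ℝ.-‿inverseˡ _))

  discreteComplexField : DiscreteField
  discreteComplexField = record
    { commutativeRing = complexField ; 1≉0 = 1≉0 ; ≈0? = ≈0?
    ; reciprocal = reciprocal ; *-reciprocal = *-reciprocal ; integral = ℂ-integral }

  -- The modulus is the supremum of the reals whose square is at most `normSq z`, and 0 is one of
  -- them.
  ∣∣-nonneg : ∀ z → ℝ.0# ℝ.≤ ∣ z ∣
  ∣∣-nonneg z = proj₁ (proj₂ (sqrt-supremum (normSq z) (normSq-nonneg z))) ℝ.0#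
    (≤-trans (inj₂ (ℝ.zeroˡ ℝ.0#)) (normSq-nonneg z))

  -- Characteristic zero, read off the real part: a positive number of ones sums to a positive real.
  -- This makes the factor r! harmless.
  ×-≉0 : ∀ n → .{{NonZero n}} → ∀ {z} → z ≉ 0# → (n · z) ≉ 0#
  ×-≉0 (suc n) {z} z≉0 e = ℂ-integral {suc n · 1#} (λ e′ → pos⇒≉0 (×1-pos n) (ℝ.trans (ℝ.sym (Re-× (suc n))) (proj₁ e′)))
    z≉0 (C.trans (C.trans (×-assoc-* (suc n) 1# z) (×-congʳ (suc n) (C.*-identityˡ z))) e)
    where
    open import Algebra.Properties.Semiring.Mult C.semiring
    Re-× : ∀ n → Re (n · 1#) ℝ.≈ RawSemiringDefinitions._×_ (rawSemiringOf ℝ.commutativeRing) n ℝ.1#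
    Re-× zero    = ℝ.refl
    Re-× (suc n) = ℝ.+-congˡ (Re-× n)

-- One-dimensional quotients of a localization

module _ {S K L : CRing} (ev : ⟨ S ⟩ → ⟨ K ⟩) (φ : ⟨ S ⟩ → ⟨ L ⟩) where
  private
    module K = CommutativeRing K
    module L = CommutativeRing L

  -- φ is the localization at the kernel of ev.
  record IsLocalizationAt : Set where
    field
      φ-hom      : IsHom S L φ
      fraction   : ∀ x → ∃₂ λ s t → ¬ (ev s K.≈ K.0#) × φ s L.* x L.≈ φ t
      invertible : ∀ s → ¬ (ev s K.≈ K.0#) → ∃ λ y → y L.* φ s L.≈ L.1#
      kernel     : ∀ s t → φ s L.≈ φ t → ev s K.≈ ev t

module LocalQuotient
  (𝕂 : DiscreteField) (S L : CRing)
  (ev : ⟨ S ⟩ → DiscreteField.Carrier 𝕂) (ev-hom : IsHom S (DiscreteField.commutativeRing 𝕂) ev)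
  (φ : ⟨ S ⟩ → ⟨ L ⟩)
  (isLocalization : IsLocalizationAt {S} {DiscreteField.commutativeRing 𝕂} {L} ev φ)
  {n : ℕ} (f : Fin n → ⟨ S ⟩)
  where
  private
    K : CRing
    K = DiscreteField.commutativeRing 𝕂
    module S = CommutativeRing S
    module K = DiscreteField 𝕂
    module L = CommutativeRing L
  open QuotientMap L (φ ∘ f)
  open Sums L using (sum)
  open IsLocalizationAt isLocalization using (fraction; invertible; kernel)
    renaming (φ-hom to φ-homL)

  Q : CRing
  Q = Quotient.quotientRing L (φ ∘ f)

  private
    module Q = CommutativeRing Q
    module ev = Hom {S} {K} ev-hom
    module φL = Hom {S} {L} φ-homL

  φ-homQ : IsHom S Q φ
  φ-homQ = Composition.isRingHomomorphism Q.trans φ-homL quotient-hom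

  private module φQ = Hom {S} {Q} φ-homQ

  φ-generator : ∀ i → φ (f i) Q.≈ Q.0#
  φ-generator = generator-zero

  φ-cancel : ∀ h {x y} → ¬ (ev h K.≈ K.0#) → φ h Q.* x Q.≈ φ h Q.* y → x Q.≈ y
  φ-cancel h {x} {y} h∉M e with invertible h h∉M
  ... | h⁻¹ , inverse = Q.trans (Q.sym (undo x)) (Q.trans (Q.*-congˡ e) (undo y))
    where
    undo : ∀ x → h⁻¹ Q.* (φ h Q.* x) Q.≈ x
    undo x = quotient-cong (L.trans (L.sym (L.*-assoc h⁻¹ (φ h) x))
      (L.trans (L.*-congʳ inverse) (L.*-identityˡ x)))

  -- x lies in the maximal ideal of L.
  Vanishes : Pred L.Carrier 0ℓ
  Vanishes x = ∃₂ λ s t → ¬ (ev s K.≈ K.0#) × ev t K.≈ K.0# × φ s L.* x L.≈ φ t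

  vanishes-+ : ∀ {x y} → Vanishes x → Vanishes y → Vanishes (x L.+ y)
  vanishes-+ {x} {y} (s , t , s∉M , t0 , e) (s′ , t′ , s′∉M , t′0 , e′) =
    s S.* s′ , t S.* s′ S.+ t′ S.* s ,
    (λ z → K.integral s∉M s′∉M (K.trans (K.sym (ev.*-hom s s′)) z)) ,
    K.trans (ev.+-hom _ _) (K.trans (K.+-cong (zero-* t0) (zero-* t′0)) (K.+-identityˡ _)) ,
    (begin
      φ (s S.* s′) L.* (x L.+ y)             ≈⟨ L.*-congʳ (φL.*-hom s s′) ⟩
      (φ s L.* φ s′) L.* (x L.+ y)
        ≈⟨ solve 4 (λ s s′ x y → (s :* s′) :* (x :+ y) := (s :* x) :* s′ :+ (s′ :* y) :* s) L.refl _ _ _ _ ⟩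
      (φ s L.* x) L.* φ s′ L.+ (φ s′ L.* y) L.* φ s ≈⟨ L.+-cong (L.*-congʳ e) (L.*-congʳ e′) ⟩
      φ t L.* φ s′ L.+ φ t′ L.* φ s ≈⟨ L.+-cong (φL.*-hom t s′) (φL.*-hom t′ s) ⟨
      φ (t S.* s′) L.+ φ (t′ S.* s)      ≈⟨ φL.+-hom _ _ ⟨
      φ (t S.* s′ S.+ t′ S.* s) ∎)
    where
    open import Relation.Binary.Reasoning.Setoid L.setoid
    open SemiringSolver L.commutativeSemiring using (solve; _:=_; _:+_; _:*_)
    zero-* : ∀ {t s} → ev t K.≈ K.0# → ev (t S.* s) K.≈ K.0#
    zero-* t0 = K.trans (ev.*-hom _ _) (K.trans (K.*-congʳ t0) (K.zeroˡ _))

  vanishes-* : ∀ x {h} → ev h K.≈ K.0# → Vanishes (x L.* φ h)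
  vanishes-* x {h} h0 with fraction x
  ... | s , t , s∉M , e = s , t S.* h , s∉M ,
    K.trans (ev.*-hom t h) (K.trans (K.*-congˡ h0) (K.zeroʳ _)) ,
    L.trans (L.sym (L.*-assoc _ _ _)) (L.trans (L.*-congʳ e) (L.sym (φL.*-hom t h)))

  vanishes-sum : ∀ {d} (x : Vector L.Carrier d) → (∀ t → Vanishes (x t)) → Vanishes (sum x)
  vanishes-sum {zero}  x p = S.1# , S.0# , (λ z → K.1≉0 (K.trans (K.sym ev.1-hom) z)) , ev.0-hom ,
    L.trans (L.zeroʳ _) (L.sym φL.0-hom)
  vanishes-sum {suc d} x p = vanishes-+ (p zero) (vanishes-sum (x ∘ suc) (p ∘ suc))

  -- Both s h and t map to s x in L, so they have the same residue: ev s · ev h = ev t = 0, while ev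
  -- s is nonzero.
  vanishes⇒≈0 : ∀ {x h} → φ h L.≈ x → Vanishes x → ev h K.≈ K.0#
  vanishes⇒≈0 {x} {h} h≈x (s , t , s∉M , t0 , e) = decidable-stable (K.≈0? _) λ h∉M → K.integral s∉M h∉M
    (K.trans (K.sym (ev.*-hom s h)) (K.trans
      (kernel (s S.* h) t (L.trans (φL.*-hom s h) (L.trans (L.*-congˡ h≈x) e))) t0))

  module _ (f≈0 : ∀ i → ev (f i) K.≈ K.0#)
    (con : ⟨ K ⟩ → ⟨ S ⟩) (con-hom : IsHom K S con) (ev-con : ∀ c → ev (con c) K.≈ c) where
    private module con = Hom {K} {S} con-hom

    -- A constant that becomes zero in Q is an L-combination of the generators. These have residue
    -- 0, so the combination lies in the maximal ideal and the constant has residue 0 as well.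
    φ-con-injective : ∀ c → φ (con c) Q.≈ Q.0# → c K.≈ K.0#
    φ-con-injective c (Quotient.congruent (g , e)) = K.trans (K.sym (ev-con c))
      (vanishes⇒≈0
        (L.trans (L.sym (L.trans (L.+-congˡ G.ε⁻¹≈ε) (L.+-identityʳ (φ (con c))))) e)
        (vanishes-sum (λ i → g i L.* φ (f i)) λ i → vanishes-* (g i) (f≈0 i)))
      where module G = AbelianGroupProperties L.+-abelianGroup

    module _ (residue : ∀ g → φ g Q.≈ φ (con (ev g))) where

      -- From s x = t the constant can only be ev t / ev s; the equality is checked after
      -- multiplication by s, a unit of Q.
      fraction-constant : ∀ x → ∃ λ c → x Q.≈ φ (con c)
      fraction-constant x with fraction x
      ... | s , t , s∉M , sx≈t = c , φ-cancel s s∉M (begin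
        φ s Q.* x                           ≈⟨ quotient-cong sx≈t ⟩
        φ t                                 ≈⟨ residue t ⟩
        φ (con (ev t))                      ≈⟨ φQ.cong (con.cong t≈s*c) ⟩
        φ (con (ev s K.* c))                ≈⟨ φQ.cong (con.*-hom (ev s) c) ⟩
        φ (con (ev s) S.* con c)            ≈⟨ φQ.*-hom (con (ev s)) (con c) ⟩
        φ (con (ev s)) Q.* φ (con c)    ≈⟨ Q.*-congʳ (residue s) ⟨
        φ s Q.* φ (con c) ∎)
        where
        open import Relation.Binary.Reasoning.Setoid Q.setoid
        c : K.Carrier
        c = K.reciprocal (ev s) K.* ev t
        t≈s*c : ev t K.≈ ev s K.* c
        t≈s*c = K.sym (K.trans (K.sym (K.*-assoc (ev s) _ _))
          (K.trans (K.*-congʳ (K.*-reciprocal _ s∉M)) (K.*-identityˡ _)))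

      dimension-1 : HasDimension K Q (φ ∘ con) 1
      dimension-1 =
          (λ _ → Q.1#)
        , (λ x → (λ _ → proj₁ (fraction-constant x)) ,
            Q.trans (proj₂ (fraction-constant x)) (Q.sym (coefficient (proj₁ (fraction-constant x)))))
        , λ { c e zero → φ-con-injective (c zero) (Q.trans (Q.sym (coefficient (c zero))) e) }
        where
        coefficient : ∀ c → φ (con c) Q.* Q.1# Q.+ Q.0# Q.≈ φ (con c)
        coefficient c = Q.trans (Q.+-identityʳ _) (Q.*-identityʳ _)

-- The Jacobian criterion at a point of an affine chart

module JacobianCriterion
  (𝕂 : DiscreteField) (L : CRing) {m n : ℕ} (a : Fin m → DiscreteField.Carrier 𝕂)
  (φ : Polynomials.Poly (DiscreteField.commutativeRing 𝕂) (Fin m) → ⟨ L ⟩)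
  (f : Fin n → Polynomials.Poly (DiscreteField.commutativeRing 𝕂) (Fin m))
  where
  private
    K : CRing
    K = DiscreteField.commutativeRing 𝕂
    module K = DiscreteField 𝕂
  open Polynomials K
  open Evaluation K
  open Taylor a

  jacobian : Fin n → Fin m → K.Carrier
  jacobian i l = eval a (taylor (f i) l)

  module _ (isLocalization : IsLocalizationAt {polynomialRing (Fin m)} {K} {L} (eval a) φ)
    (f≈0 : ∀ i → eval a (f i) K.≈ K.0#)
    (trivialKernel : ∀ y → (∀ i → Sums._∙_ K (jacobian i) y K.≈ K.0#) → ∀ l → y l K.≈ K.0#) where
    open LocalQuotient 𝕂 (polynomialRing (Fin m)) L (eval a) (eval-hom a) φ isLocalization f
    private
      module Q = CommutativeRing Q
      module φ = Hom {polynomialRing (Fin m)} {Q} φ-homQ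

    -- Expanding f_i = 0 in Q at the zero a of f_i leaves a linear relation among the differences
    -- `ξ`. Its coefficients have the Jacobian as residues, so elimination gives `ξ` = 0.
    variables-constant : ∀ l → φ (var l) Q.≈ φ (con (a l))
    variables-constant l = G.x∙y⁻¹≈ε⇒x≈y (φ (var l)) (φ (con (a l)))
      (trivialKernel⇒zero (eval-hom a) φ-homQ
        (λ h {q} h∉M e → φ-cancel h {q} {Q.0#} h∉M (Q.trans e (Q.sym (Q.zeroʳ (φ h)))))
        m (λ i → taylor (f i)) trivialKernel ξ relation l)
      where
      module G = AbelianGroupProperties Q.+-abelianGroup
      open Elimination (polynomialRing (Fin m)) 𝕂 Q (eval a) φ
      ξ : Fin m → Q.Carrier
      ξ l = φ (var l) Q.- φ (con (a l))
      relation : ∀ i → Sums._∙_ Q (φ ∘ taylor (f i)) ξ Q.≈ Q.0#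
      relation i = Q.trans (Q.sym (Q.+-identityˡ _)) (Q.trans
        (Q.+-congʳ (Q.sym (Q.trans (φ.cong (con-cong (f≈0 i))) φ.0-hom)))
        (Q.trans (Q.sym (taylor-expansion Q φ-homQ (f i))) (φ-generator i)))

    trivialKernel⇒dimension-1 : HasDimension K Q (φ ∘ con) 1
    trivialKernel⇒dimension-1 = dimension-1 f≈0 con (con-hom (Fin m)) (λ _ → K.refl)
      (constant-residues⇒constant Q φ-homQ variables-constant)

atPoint-isLocalization : (ℝ : CompleteOrderedField) → let open Tensors ℝ in ∀ {m} (a : Fin m → ℂ) →
  IsLocalizationAt {polynomialRing (Fin m)} {complexField} {AtPoint.localization a} (eval a) (AtPoint.fromS a)
atPoint-isLocalization ℝ {m} a = record
  { φ-hom      = fromS-hom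
  ; fraction   = λ x → den x , num x , den∈D x , den-clears x
  ; invertible = λ s s∉M → con 1# ÷ s [ s∉M ] , inverse s∉M
  -- Equality of fractions holds up to a factor u outside the maximal ideal; the value of u at a is
  -- nonzero and cancels.
  ; kernel     = λ s t (scale u u∉M e) → cancelˡ-≈ u∉M (ev-fromS e)
  }
  where
  open Tensors ℝ
  open ComplexFacts ℝ
  open AtPoint a
  open LocalizationMap (polynomialRing (Fin m)) OutsideM 1∉M ℂ-integral
  open Hom {polynomialRing (Fin m)} {complexField} (Evaluation.eval-hom complexField a)
  module C = CommutativeRing complexField
  ev-fromS : ∀ {u s t} → u ⊗ (s ⊗ con 1#) ≋ u ⊗ (t ⊗ con 1#) → eval a u * eval a s ≈ eval a u * eval a t
  ev-fromS e = C.trans (C.*-congˡ (C.sym (C.*-identityʳ _))) (C.trans (cong e) (C.*-congˡ (C.*-identityʳ _)))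

-- Sums over index tuples and the maximum principle

module Forms (ℝ : CompleteOrderedField) where
  open Tensors ℝ
  open OrderedField ℝ
  private module ℝ = CompleteOrderedField ℝ

  module _ (R T : CRing) {ιR : ℂ → ⟨ R ⟩} {ιT : ℂ → ⟨ T ⟩} where
    private
      module R = CommutativeRing R
      module T = CommutativeRing T
      module RS = Sums R
      module TS = Sums T

    sum-map : ∀ {h : R.Carrier → T.Carrier} → h R.0# T.≈ T.0# → (∀ x y → h (x R.+ y) T.≈ h x T.+ h y) →
      ∀ {n} (f : Vector R.Carrier n) → h (RS.sum f) T.≈ TS.sum (h ∘ f)
    sum-map h-0 h-+ {zero}  f = h-0
    sum-map h-0 h-+ {suc n} f = T.trans (h-+ _ _) (T.+-congˡ (sum-map h-0 h-+ (f ∘ suc)))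

    -- Only additivity is asked of h, so that it can be an evaluation, a multiplication by a
    -- constant, a real or imaginary part, or the operator `E` of the logarithmic derivative.
    Σ-indices-map : ∀ {h : R.Carrier → T.Carrier} → h R.0# T.≈ T.0# → (∀ x y → h (x R.+ y) T.≈ h x T.+ h y) →
      ∀ d {n} (g : Vec (Fin n) d → R.Carrier) → h (Σ-indices R ιR d g) T.≈ Σ-indices T ιT d (h ∘ g)
    Σ-indices-map h-0 h-+ zero    g = T.refl
    Σ-indices-map h-0 h-+ (suc d) g = T.trans (sum-map h-0 h-+ (λ i → Σ-indices R ιR d (λ v → g (i ∷ v))))
      (TS.sum-cong-≋ λ i → Σ-indices-map h-0 h-+ d (λ v → g (i ∷ v)))

  Σ-indices-cong : ∀ (T : CRing) {ι} → let module T = CommutativeRing T in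
    ∀ d {n} {g h : Vec (Fin n) d → T.Carrier} →
    (∀ v → g v T.≈ h v) → Σ-indices T ι d g T.≈ Σ-indices T ι d h
  Σ-indices-cong T zero    e = e []
  Σ-indices-cong T (suc d) e = Sums.sum-cong-≋ T λ i → Σ-indices-cong T d λ v → e (i ∷ v)

  -- Σ-indices does not depend on its structure map, so any map ℂ → ℝ will do.
  Σℝ : ∀ d {n} → (Vec (Fin n) d → ℝ.Carrier) → ℝ.Carrier
  Σℝ = Σ-indices ℝ.commutativeRing Re

  Σℝ-nonneg : ∀ d {n} (g : Vec (Fin n) d → ℝ.Carrier) → (∀ v → ℝ.0# ℝ.≤ g v) → ℝ.0# ℝ.≤ Σℝ d g
  Σℝ-nonneg zero    g p = p []
  Σℝ-nonneg (suc d) g p = sum-nonneg _ λ i → Σℝ-nonneg d (λ v → g (i ∷ v)) (λ v → p (i ∷ v))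

  Σℝ≈0 : ∀ d {n} (g : Vec (Fin n) d → ℝ.Carrier) → (∀ v → ℝ.0# ℝ.≤ g v) → Σℝ d g ℝ.≈ ℝ.0# → ∀ v → g v ℝ.≈ ℝ.0#
  Σℝ≈0 zero    g p e []      = e
  Σℝ≈0 (suc d) g p e (i ∷ v) = Σℝ≈0 d (λ v → g (i ∷ v)) (λ v → p (i ∷ v))
    (sum≈0 _ (λ i → Σℝ-nonneg d (λ v → g (i ∷ v)) (λ v → p (i ∷ v))) e i) v

  module _ {r n} (w : Fin (suc n) → Vec (Fin (suc n)) r → ℝ.Carrier)
    (w-nonneg : ∀ i v → ℝ.0# ℝ.≤ w i v)
    {arc : Rel (Fin (suc n)) 0ℓ} (arc-pos : ∀ {i l} → arc i l → i ≡ l ⊎ ∃ λ v → ℝ.0# ℝ.< w i v × l ∈ v)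
    (ζ : Fin (suc n) → ℝ.Carrier) where
    open Sums ℝ.commutativeRing

    -- At a maximum all gaps ζ i - ζ l are nonnegative, so a vanishing weighted sum of them vanishes
    -- term by term; a positive weight then forces its own gaps to be zero.
    harmonic-step : ∀ {i l} → Σℝ r (λ v → w i v ℝ.* sum (λ t → ζ i ℝ.- ζ (lookup v t))) ℝ.≈ ℝ.0# →
      (∀ j → ζ j ℝ.≤ ζ i) → arc i l → ζ l ℝ.≈ ζ i
    harmonic-step {i} harm max a with arc-pos a
    ... | inj₁ ≡.refl = ℝ.refl
    ... | inj₂ (v , w>0 , l∈v) = ℝ.sym (ℝ.trans (G.x∙y⁻¹≈ε⇒x≈y _ _ gap≈0) (ℝ.reflexive (≡.cong ζ (≡.sym (lookup-index l∈v)))))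
      where
      module G = AbelianGroupProperties ℝ.+-abelianGroup
      gap-nonneg : ∀ v (t : Fin r) → ℝ.0# ℝ.≤ ζ i ℝ.- ζ (lookup v t)
      gap-nonneg v t = x≤y⇒0≤y-x (max (lookup v t))
      gap≈0 : ζ i ℝ.- ζ (lookup v (index l∈v)) ℝ.≈ ℝ.0#
      gap≈0 = sum≈0 (λ t → ζ i ℝ.- ζ (lookup v t)) (gap-nonneg v)
        (pos*nonneg≈0 w>0 (sum-nonneg _ (gap-nonneg v))
          (Σℝ≈0 r _ (λ v → *-nonneg (w-nonneg i v) (sum-nonneg _ (gap-nonneg v))) harm v))
        (index l∈v)

    -- An arc leads from a maximiser to a vertex of the same value, which is again a maximiser.
    -- Hence the maximum spreads along paths from one maximiser to all vertices.
    maximum-principle : (∀ i → Σℝ r (λ v → w i v ℝ.* sum (λ t → ζ i ℝ.- ζ (lookup v t))) ℝ.≈ ℝ.0#) →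
      (∀ i j → Star arc i j) → ∀ i j → ζ i ℝ.≈ ζ j
    maximum-principle harm connected i j with argmax ζ
    ... | i₀ , max = ℝ.trans (spread (connected i₀ i) max) (ℝ.sym (spread (connected i₀ j) max))
      where
      spread : ∀ {k l} → Star arc k l → (∀ j → ζ j ℝ.≤ ζ k) → ζ l ℝ.≈ ζ k
      spread ε max = ℝ.refl
      spread (a ◅ as) max = ℝ.trans (spread as (λ j → ≤-respʳ (ℝ.sym e) (max j))) e
        where e = harmonic-step (harm _) max a

-- Logarithmic differentiation of the eigen-equations

module LogarithmicDerivative (ℝ : CompleteOrderedField) where
  open Tensors ℝ
  open Forms ℝ
  private module C = CommutativeRing complexField
  open C using (_+_; -_; _-_; refl; sym; trans; +-cong; +-congˡ; *-cong; *-congˡ; *-congʳ)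
  private
    module C′ = RingProperties C.ring
    module G = AbelianGroupProperties C.+-abelianGroup
  open Sums complexField
  open SemiringSolver C.commutativeSemiring using (solve; _:=_; _:+_; _:*_)

  -- `ev` and `D` are known by their rules alone: they will be evaluation and directional derivative
  -- in the chart, precomposed with x_j ↦ 1. The computation can thus stay in all n homogeneous
  -- variables, where no index is special.
  module Derivation {n} (ev D : Poly (Fin n) → ℂ)
    (ev-con : ∀ c → ev (con c) ≈ c)
    (ev-⊕ : ∀ f g → ev (f ⊕ g) ≈ ev f + ev g)
    (ev-⊗ : ∀ f g → ev (f ⊗ g) ≈ ev f * ev g)
    (ev-⊝ : ∀ f → ev (⊝ f) ≈ - ev f)
    (D-con : ∀ c → D (con c) ≈ 0#)
    (D-⊕ : ∀ f g → D (f ⊕ g) ≈ D f + D g)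
    (D-⊗ : ∀ f g → D (f ⊗ g) ≈ D f * ev g + ev f * D g)
    (D-⊝ : ∀ f → D (⊝ f) ≈ - D f)
    where

    private
      P : CRing
      P = polynomialRing (Fin n)
      module P = RawSemiringDefinitions (rawSemiringOf P)
      module CS = RawSemiringDefinitions (rawSemiringOf complexField)

    ev-power : ∀ f r → ev (f P.^ r) ≈ ev f ^ r
    ev-power f zero    = ev-con 1#
    ev-power f (suc r) = trans (ev-⊗ _ _) (*-congˡ (ev-power f r))

    ev-product : ∀ {d} (g : Vector (Poly (Fin n)) d) → ev (P.product g) ≈ CS.product (ev ∘ g)
    ev-product {zero}  g = ev-con 1#
    ev-product {suc d} g = trans (ev-⊗ _ _) (*-congˡ (ev-product (g ∘ suc)))

    ev-term : ∀ {d} b (v : Vec (Fin n) d) →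
      ev (con b ⊗ monomial P con v var) ≈ b * monomial complexField id v (ev ∘ var)
    ev-term b v = trans (ev-⊗ _ _) (*-cong (ev-con b) (ev-product (λ t → var (lookup v t))))

    ev-contract : ∀ {r} (𝒜 : Tensor (suc r) n) i →
      ev (contract P con 𝒜 var i) ≈ contract complexField id 𝒜 (ev ∘ var) i
    ev-contract {r} 𝒜 i = trans (Σ-indices-map P complexField {con} {id} {ev} (ev-con 0#) ev-⊕ r (λ v → con (𝒜 (i ∷ v)) ⊗ monomial P con v var))
      (Σ-indices-cong complexField r λ v → ev-term (𝒜 (i ∷ v)) v)

    ev-eigenPolynomial : ∀ {r} μ (𝒜 : Tensor (suc r) n) → EigenEquation 𝒜 μ (ev ∘ var) →
      ∀ i → ev (eigenPolynomial μ 𝒜 i) ≈ 0#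
    ev-eigenPolynomial {r} μ 𝒜 eq i = trans (ev-⊕ _ _) (trans (+-cong
      (trans (ev-⊗ _ _) (*-cong (ev-con μ) (ev-power (var i) r)))
      (trans (ev-⊝ _) (C.-‿cong (trans (ev-contract 𝒜 i) (eq i)))))
      (C.-‿inverseʳ _))

    -- Written without division, so that it also covers vanishing polynomials, such as terms with a
    -- zero tensor entry.
    HasLogDerivative : Poly (Fin n) → ℂ → Set
    HasLogDerivative f s = D f ≈ s * ev f

    log-con : ∀ c → HasLogDerivative (con c) 0#
    log-con c = trans (D-con c) (sym (C.zeroˡ _))

    log-⊗ : ∀ {f g s t} → HasLogDerivative f s → HasLogDerivative g t → HasLogDerivative (f ⊗ g) (s + t)
    log-⊗ {f} {g} {s} {t} p q = trans (D-⊗ f g) (trans (+-cong (*-congʳ p) (*-congˡ q))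
      (trans (solve 4 (λ s t f g → (s :* f) :* g :+ f :* (t :* g) := (s :+ t) :* (f :* g)) refl s t (ev f) (ev g))
        (*-congˡ (sym (ev-⊗ f g)))))

    log-product : ∀ {d} (g : Vector (Poly (Fin n)) d) (s : Vector ℂ d) →
      (∀ t → HasLogDerivative (g t) (s t)) → HasLogDerivative (P.product g) (sum s)
    log-product {zero}  g s p = log-con 1#
    log-product {suc d} g s p = log-⊗ {g zero} {P.product (g ∘ suc)} (p zero) (log-product (g ∘ suc) (s ∘ suc) (p ∘ suc))

    log-power : ∀ {f s} r → HasLogDerivative f s → HasLogDerivative (f P.^ r) (sum {r} (λ _ → s))
    log-power         zero    p = log-con 1#
    log-power {f} {s} (suc r) p = log-⊗ {f} {f P.^ r} p (log-power {f} {s} r p)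

    module _ (z : Fin n → ℂ) (log-var : ∀ i → HasLogDerivative (var i) (z i)) where

      -- E = s · ev − D kills μ xᵢ^r for s = r zᵢ, so only the terms of the
      -- contraction survive.
      log-eigenPolynomial : ∀ {r} μ (𝒜 : Tensor (suc r) n) i →
        ev (eigenPolynomial μ 𝒜 i) ≈ 0# → D (eigenPolynomial μ 𝒜 i) ≈ 0# →
        Σ-indices complexField id r (λ v →
          sum (λ t → z i - z (lookup v t)) * (𝒜 (i ∷ v) * monomial complexField id v (ev ∘ var))) ≈ 0#
      log-eigenPolynomial {r} μ 𝒜 i evF≈0 DF≈0 = trans
        (Σ-indices-cong complexField r λ v → sym (E-term v))
        (trans (sym (Σ-indices-map P complexField {con} {id} {E} E-0 E-⊕ r term)) E-contract)
        where
        -- This is r z_i in the form that the product rule gives for μ xᵢ^r; the leading `0#` is the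
        -- contribution of the constant μ.
        s : ℂ
        s = 0# + sum {r} (λ _ → z i)

        E : Poly (Fin n) → ℂ
        E f = s * ev f - D f

        term : Vec (Fin n) r → Poly (Fin n)
        term v = con (𝒜 (i ∷ v)) ⊗ monomial P con v var

        E-log : ∀ {f t} → HasLogDerivative f t → E f ≈ (s - t) * ev f
        E-log {f} {t} p = trans (+-congˡ (C.-‿cong p)) (sym (C′.[y-z]x≈yx-zx (ev f) s t))

        E-⊕ : ∀ f g → E (f ⊕ g) ≈ E f + E g
        E-⊕ f g = trans (+-cong (trans (*-congˡ (ev-⊕ f g)) (C.distribˡ _ _ _))
            (trans (C.-‿cong (D-⊕ f g)) (sym (G.⁻¹-∙-comm _ _))))
          (solve 4 (λ a b c d → (a :+ b) :+ (c :+ d) := (a :+ c) :+ (b :+ d)) refl _ _ _ _)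

        E-⊝ : ∀ f → E (⊝ f) ≈ - E f
        E-⊝ f = trans (+-cong (trans (*-congˡ (ev-⊝ f)) (sym (C′.-‿distribʳ-* _ _))) (C.-‿cong (D-⊝ f)))
          (G.⁻¹-∙-comm _ _)

        power contraction : Poly (Fin n)
        power = con μ ⊗ (var i P.^ r)
        contraction = contract P con 𝒜 var i

        E-0 : E (con 0#) ≈ 0#
        E-0 = trans (E-log {con 0#} (log-con 0#)) (trans (*-congˡ (ev-con 0#)) (C.zeroʳ _))

        E-power : E power ≈ 0#
        E-power = trans
          (E-log {power} (log-⊗ {con μ} {var i P.^ r} (log-con μ) (log-power {var i} {z i} r (log-var i))))
          (trans (*-congʳ (C.-‿inverseʳ s)) (C.zeroˡ _))

        E-eigenPolynomial : E (power ⊕ ⊝ contraction) ≈ 0#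
        E-eigenPolynomial = trans (+-cong (trans (*-congˡ evF≈0) (C.zeroʳ _)) (trans (C.-‿cong DF≈0) G.ε⁻¹≈ε))
          (C.+-identityʳ _)

        E-contract : E contraction ≈ 0#
        E-contract = sym (G.x∙y⁻¹≈ε⇒x≈y _ _
          (trans (+-cong (sym E-power) (sym (E-⊝ contraction)))
            (trans (sym (E-⊕ power (⊝ contraction))) E-eigenPolynomial)))

        E-term : ∀ v → E (term v) ≈
          sum (λ t → z i - z (lookup v t)) * (𝒜 (i ∷ v) * monomial complexField id v (ev ∘ var))
        E-term v = trans
          (E-log {term v} (log-⊗ {con (𝒜 (i ∷ v))} {monomial P con v var} (log-con _)
            (log-product (λ t → var (lookup v t)) (λ t → z (lookup v t)) (λ t → log-var (lookup v t)))))
          (*-cong (trans (+-cong (C.+-identityˡ _) (C.-‿cong (C.+-identityˡ _)))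
                    (sym (sum-minus (λ _ → z i) (λ t → z (lookup v t)))))
            (ev-term (𝒜 (i ∷ v)) v))

punchIn-elim : ∀ {n} (P : Pred (Fin (suc n)) 0ℓ) j → P j → (∀ l → P (punchIn j l)) → ∀ i → P i
punchIn-elim P j Pj P₊ i with j ≟ᶠ i
... | yes ≡.refl = Pj
... | no j≢i = ≡.subst P (punchIn-punchOut j≢i) (P₊ (punchOut j≢i))

-- Positive edge weights from the phase condition

module EdgeWeights (ℝ : CompleteOrderedField) where
  open Tensors ℝ
  open OrderedField ℝ
  open ComplexFacts ℝ
  open Forms ℝ
  private
    module ℝ = CompleteOrderedField ℝ
    module GR = AbelianGroupProperties ℝ.+-abelianGroup
    module C = CommutativeRing complexField
    module CS = RawSemiringDefinitions (rawSemiringOf complexField)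
  open C using (_+_; -_; _-_; refl; sym; trans; +-cong; +-congˡ; *-cong; *-congˡ; *-congʳ)
  open Sums complexField
  open import Algebra.Properties.Semiring.Mult C.semiring using (×-congʳ; ×-assoc-*)
  open SemiringSolver C.commutativeSemiring using (solve; _:=_; _:+_; _:*_)

  product-≉0 : ∀ {d} (x : Vector ℂ d) → (∀ t → x t ≉ 0#) → CS.product x ≉ 0#
  product-≉0 {zero}  x p = 1≉0
  product-≉0 {suc d} x p = ℂ-integral (p zero) (product-≉0 (x ∘ suc) (p ∘ suc))

  power-≉0 : ∀ {c} → c ≉ 0# → ∀ d → (c ^ d) ≉ 0#
  power-≉0 p zero    = 1≉0
  power-≉0 p (suc d) = ℂ-integral p (power-≉0 p d)

  module Incidence
    {r m : ℕ} (𝒜 : Tensor (suc r) (suc m)) (irreducible : WeaklyIrreducible 𝒜)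
    (distinct : ∃₂ λ (i j : Fin (suc m)) → ¬ (i ≡ j))
    (support : ∀ v → 𝒜 v ≉ 0# → AllEqual v ⊎ Unique v)
    (p : ℙ (suc m)) (p≉0 : ∀ i → coord p i ≉ 0#)
    (u : ℂ) (phase : ∀ v → Unique v → 𝒜 v ≉ 0# → edgeTerm 𝒜 p v ≈ real ∣ edgeTerm 𝒜 p v ∣ * u)
    where
    private
      n : ℕ
      n = suc m

    edge-≉0 : ∀ {v} → 𝒜 v ≉ 0# → edgeTerm 𝒜 p v ≉ 0#
    edge-≉0 {v} 𝒜v≉0 = ℂ-integral (×-≉0 (r !) {{r !≢0}} 𝒜v≉0) (product-≉0 _ (λ t → p≉0 (lookup v t)))

    loop-arc : ∀ {i l} {v : Vec (Fin n) r} → AllEqual (i ∷ v) → l ∈ v → i ≡ l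
    loop-arc (i≡ ∷ _) l∈v = All-lookup i≡ l∈v

    -- With u = 0 the phase condition would annihilate the edge terms, which are nonzero. Every arc
    -- would then come from a diagonal entry and be a loop, so no path could join two distinct
    -- vertices.
    u≉0 : u ≉ 0#
    u≉0 u≈0 = proj₂ (proj₂ distinct) (trivial (irreducible _ _))
      where
      trivial-arc : ∀ {i l} → Arc 𝒜 i l → i ≡ l
      trivial-arc {i} (v , 𝒜v≉0 , l∈v) with support (i ∷ v) 𝒜v≉0
      ... | inj₁ loop = loop-arc loop l∈v
      ... | inj₂ uniq = ⊥-elim (edge-≉0 𝒜v≉0 (trans (phase (i ∷ v) uniq 𝒜v≉0) (trans (*-congˡ u≈0) (C.zeroʳ _))))

      trivial : ∀ {i l} → Star (Arc 𝒜) i l → i ≡ l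
      trivial ε        = ≡.refl
      trivial (a ◅ as) = ≡.trans (trivial-arc a) (trivial as)

    -- Diagonal entries have an arbitrary phase and get weight 0. `factors` therefore does not
    -- equate the edge term with u times the weight, but only their products with an s that vanishes
    -- on diagonal tuples; s will be the sum of the gaps of z.
    record Weight (v : Vec (Fin n) (suc r)) : Set where
      field
        weight  : ℝ.Carrier
        nonneg  : ℝ.0# ℝ.≤ weight
        factors : ∀ s → (AllEqual v → s ≈ 0#) → edgeTerm 𝒜 p v * s ≈ u * (real weight * s)
        pos     : 𝒜 v ≉ 0# → AllEqual v ⊎ ℝ.0# ℝ.< weight

    open Weight

    edgeWeight : ∀ v → Weight v
    edgeWeight v with ≈0? (𝒜 v)
    ... | yes 𝒜v≈0 = record
      { weight = ℝ.0# ; nonneg = inj₂ ℝ.refl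
      ; factors = λ s _ → trans (*-congʳ (trans (*-congʳ r!𝒜v≈0) (C.zeroˡ _)))
          (trans (C.zeroˡ s) (sym (trans (*-congˡ (C.zeroˡ s)) (C.zeroʳ u))))
      ; pos = λ 𝒜v≉0 → ⊥-elim (𝒜v≉0 𝒜v≈0) }
      where
      r!𝒜v≈0 : (r !) · 𝒜 v ≈ 0#
      r!𝒜v≈0 = trans (×-congʳ (r !) (trans 𝒜v≈0 (sym (C.zeroʳ 1#))))
        (trans (sym (×-assoc-* (r !) 1# 0#)) (C.zeroʳ _))
    ... | no 𝒜v≉0 with support v 𝒜v≉0
    ...   | inj₁ loop = record
      { weight = ℝ.0# ; nonneg = inj₂ ℝ.refl
      ; factors = λ s s≈0 → trans (trans (*-congˡ (s≈0 loop)) (C.zeroʳ _))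
          (sym (trans (*-congˡ (C.zeroˡ s)) (C.zeroʳ u)))
      ; pos = λ _ → inj₁ loop }
    ...   | inj₂ uniq = record
      { weight = ∣ e ∣ ; nonneg = ∣∣-nonneg e
      ; factors = λ s _ → trans (*-congʳ (phase v uniq 𝒜v≉0))
          (solve 3 (λ w u s → (w :* u) :* s := u :* (w :* s)) refl (real ∣ e ∣) u s)
      ; pos = λ _ → inj₂ (positive (∣∣-nonneg e)) }
      where
      e : ℂ
      e = edgeTerm 𝒜 p v
      -- If the modulus were 0, the phase condition itself would make e = 0.
      positive : ℝ.0# ℝ.≤ ∣ e ∣ → ℝ.0# ℝ.< ∣ e ∣
      positive (inj₁ 0<e) = 0<e
      positive (inj₂ 0≈e) = ⊥-elim (edge-≉0 𝒜v≉0 (trans (phase v uniq 𝒜v≉0)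
        (trans (*-congʳ (ℝ.sym 0≈e , ℝ.refl)) (C.zeroˡ u))))

    w : Fin n → Vec (Fin n) r → ℝ.Carrier
    w i v = weight (edgeWeight (i ∷ v))

    arc-pos : ∀ {i l} → Arc 𝒜 i l → i ≡ l ⊎ ∃ λ v → ℝ.0# ℝ.< w i v × l ∈ v
    arc-pos {i} (v , 𝒜v≉0 , l∈v) with pos (edgeWeight (i ∷ v)) 𝒜v≉0
    ... | inj₁ loop = inj₁ (loop-arc loop l∈v)
    ... | inj₂ 0<w  = inj₂ (v , 0<w , l∈v)

    module _ {q : Fin n → ℂ} {c} (c≉0 : c ≉ 0#) (q≈cp : ∀ i → q i ≈ c * coord p i) where

      monomial-scale : ∀ {d} (v : Vec (Fin n) d) →
        monomial complexField id v q ≈ (c ^ d) * monomial complexField id v (coord p)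
      monomial-scale []      = sym (C.*-identityˡ 1#)
      monomial-scale {suc d} (i ∷ v) = trans (*-cong (q≈cp i) (monomial-scale v))
        (solve 4 (λ c x d y → (c :* x) :* (d :* y) := (c :* d) :* (x :* y)) refl _ _ _ _)

      eigenEquation-scale : ∀ {μ} → EigenEquation 𝒜 μ (coord p) → EigenEquation 𝒜 μ q
      eigenEquation-scale {μ} eq i = begin
        contract complexField id 𝒜 q i
          ≈⟨ Σ-indices-cong complexField r (λ v → trans (*-congˡ (monomial-scale v))
               (solve 3 (λ a c x → a :* (c :* x) := c :* (a :* x)) refl _ _ _)) ⟩
        Σ-indices complexField id r (λ v → (c ^ r) * term v)
          ≈⟨ Σ-indices-map complexField complexField (C.zeroʳ (c ^ r)) (C.distribˡ (c ^ r)) r term ⟨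
        (c ^ r) * contract complexField id 𝒜 (coord p) i ≈⟨ *-congˡ (eq i) ⟩
        (c ^ r) * (μ * (coord p i ^ r))
          ≈⟨ solve 3 (λ c μ x → c :* (μ :* x) := μ :* (c :* x)) refl _ _ _ ⟩
        μ * ((c ^ r) * (coord p i ^ r))        ≈⟨ *-congˡ (^-distrib-* c (coord p i) r) ⟨
        μ * ((c * coord p i) ^ r)              ≈⟨ *-congˡ (^-congˡ r (q≈cp i)) ⟨
        μ * (q i ^ r) ∎
        where
        open import Relation.Binary.Reasoning.Setoid C.setoid
        open import Algebra.Properties.CommutativeSemiring.Exp C.commutativeSemiring using (^-distrib-*)
        open import Algebra.Properties.Semiring.Exp C.semiring using (^-congˡ)
        term : Vec (Fin n) r → ℂ
        term v = 𝒜 (i ∷ v) * monomial complexField id v (coord p)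

      -- The factor q i completes q^v to the monomial of the whole tuple and r! turns the entry into
      -- c_e; passing from p to q costs one c for each of the `suc r` indices.
      edge-scale : ∀ i v → (c ^ suc r) * edgeTerm 𝒜 p (i ∷ v) ≈
        (((r !) · 1#) * q i) * (𝒜 (i ∷ v) * monomial complexField id v q)
      edge-scale i v = sym (begin
        (((r !) · 1#) * q i) * (a * monomial complexField id v q)
          ≈⟨ *-cong (*-congˡ (q≈cp i)) (*-congˡ (monomial-scale v)) ⟩
        (((r !) · 1#) * (c * x)) * (a * ((c ^ r) * y))
          ≈⟨ solve 6 (λ f c x a d y → (f :* (c :* x)) :* (a :* (d :* y)) := (c :* d) :* ((f :* a) :* (x :* y)))
               refl _ _ _ _ _ _ ⟩
        (c ^ suc r) * ((((r !) · 1#) * a) * (x * y))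
          ≈⟨ *-congˡ (*-congʳ (trans (×-assoc-* (r !) 1# a) (×-congʳ (r !) (C.*-identityˡ a)))) ⟩
        (c ^ suc r) * edgeTerm 𝒜 p (i ∷ v) ∎)
        where
        open import Relation.Binary.Reasoning.Setoid C.setoid
        a = 𝒜 (i ∷ v)
        x = coord p i
        y = monomial complexField id v (coord p)

      module _ (z : Fin n → ℂ) (kernel : ∀ i → Σ-indices complexField id r (λ v →
          sum (λ t → z i - z (lookup v t)) * (𝒜 (i ∷ v) * monomial complexField id v q)) ≈ 0#) where

        gap : Fin n → Vec (Fin n) r → ℂ
        gap i v = sum (λ t → z i - z (lookup v t))

        loop-gap : ∀ i v → AllEqual (i ∷ v) → gap i v ≈ 0#
        loop-gap i v loop = sum-zero _ λ t →
          trans (+-congˡ (C.-‿cong (C.reflexive (≡.cong z (≡.sym (loop-arc loop (∈-lookup t v)))))))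
            (C.-‿inverseʳ (z i))

        weighted-gap : ∀ i v → ((c ^ suc r) * u) * (real (w i v) * gap i v) ≈
          (((r !) · 1#) * q i) * (gap i v * (𝒜 (i ∷ v) * monomial complexField id v q))
        weighted-gap i v = begin
          ((c ^ suc r) * u) * (real (w i v) * gap i v)   ≈⟨ C.*-assoc _ _ _ ⟩
          (c ^ suc r) * (u * (real (w i v) * gap i v))   ≈⟨ *-congˡ (factors (edgeWeight (i ∷ v)) _ (loop-gap i v)) ⟨
          (c ^ suc r) * (edgeTerm 𝒜 p (i ∷ v) * gap i v) ≈⟨ C.*-assoc _ _ _ ⟨
          ((c ^ suc r) * edgeTerm 𝒜 p (i ∷ v)) * gap i v ≈⟨ *-congʳ (edge-scale i v) ⟩
          ((((r !) · 1#) * q i) * (𝒜 (i ∷ v) * monomial complexField id v q)) * gap i v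
            ≈⟨ solve 3 (λ a b g → (a :* b) :* g := a :* (g :* b)) refl _ _ _ ⟩
          (((r !) · 1#) * q i) * (gap i v * (𝒜 (i ∷ v) * monomial complexField id v q)) ∎
          where open import Relation.Binary.Reasoning.Setoid C.setoid

        -- The factor c^(r+1) u is the same for all v, so it comes out of the sum and cancels. Here
        -- it matters that the edges share a single phase.
        weighted-gaps≈0 : ∀ i → Σ-indices complexField id r (λ v → real (w i v) * gap i v) ≈ 0#
        weighted-gaps≈0 i = cancelˡ (ℂ-integral (power-≉0 c≉0 (suc r)) u≉0)
          (trans (scale-sum _ (λ v → real (w i v) * gap i v))
          (trans (Σ-indices-cong complexField r (weighted-gap i))
          (trans (sym (scale-sum (((r !) · 1#) * q i) (λ v → gap i v * (𝒜 (i ∷ v) * monomial complexField id v q))))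
          (trans (*-congˡ (kernel i)) (C.zeroʳ _)))))
          where
          scale-sum : ∀ k (g : Vec (Fin n) r → ℂ) →
            k * Σ-indices complexField id r g ≈ Σ-indices complexField id r (λ v → k * g v)
          scale-sum k g = Σ-indices-map complexField complexField (C.zeroʳ k) (C.distribˡ k) r g

        module Part (part : ℂ → ℝ.Carrier)
          (part-cong : ∀ {x y} → x ≈ y → part x ℝ.≈ part y)
          (part-0 : part 0# ℝ.≈ ℝ.0#)
          (part-+ : ∀ x y → part (x + y) ℝ.≈ part x ℝ.+ part y)
          (part-neg : ∀ x → part (- x) ℝ.≈ ℝ.- part x)
          (part-real : ∀ a x → part (real a * x) ℝ.≈ a ℝ.* part x) where

          part-harmonic : ∀ i → Σℝ r (λ v → w i v ℝ.*
            Sums.sum ℝ.commutativeRing (λ t → part (z i) ℝ.- part (z (lookup v t)))) ℝ.≈ ℝ.0#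
          part-harmonic i = ℝ.trans (ℝ.sym (ℝ.trans
            (Σ-indices-map complexField ℝ.commutativeRing {id} {Re} part-0 part-+ r (λ v → real (w i v) * gap i v))
            (Σ-indices-cong ℝ.commutativeRing r λ v → ℝ.trans (part-real _ _) (ℝ.*-congˡ (ℝ.trans
              (sum-map complexField ℝ.commutativeRing {id} {Re} part-0 part-+ (λ t → z i - z (lookup v t)))
              (Sums.sum-cong-≋ ℝ.commutativeRing λ t →
                ℝ.trans (part-+ (z i) (- z (lookup v t))) (ℝ.+-congˡ (part-neg (z (lookup v t))))))))))
            (ℝ.trans (part-cong (weighted-gaps≈0 i)) part-0)

          part-constant : ∀ i j → part (z i) ℝ.≈ part (z j)
          part-constant = maximum-principle w (λ i v → nonneg (edgeWeight (i ∷ v))) arc-pos (part ∘ z)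
            part-harmonic irreducible

        constant : ∀ i j → z i ≈ z j
        constant i j =
            Part.part-constant Re proj₁ ℝ.refl (λ _ _ → ℝ.refl) (λ _ → ℝ.refl)
              (λ a x → ℝ.trans (ℝ.+-congˡ (ℝ.trans (ℝ.-‿cong (ℝ.zeroˡ _)) GR.ε⁻¹≈ε)) (ℝ.+-identityʳ _)) i j
          , Part.part-constant Im proj₂ ℝ.refl (λ _ _ → ℝ.refl) (λ _ → ℝ.refl)
              (λ a x → ℝ.trans (ℝ.+-congˡ (ℝ.zeroˡ _)) (ℝ.+-identityʳ _)) i j

    -- Triviality of the Jacobian kernel in a chart

    module _ {μ} (p∈𝕍 : EigenEquation 𝒜 μ (coord p)) (j : Fin n) (a : Fin m → ℂ) {c} (c≉0 : c ≉ 0#)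
      (chart : ∀ i → eval a (insertAt var j (con 1#) i) ≈ c * coord p i) where

      open LogarithmicDerivative ℝ

      σ : Fin n → Poly (Fin m)
      σ = insertAt var j (con 1#)

      ev : Poly (Fin n) → ℂ
      ev = eval a ∘ substitute σ

      ev-var≉0 : ∀ i → ev (var i) ≉ 0#
      ev-var≉0 i e = ℂ-integral c≉0 (p≉0 i) (trans (sym (chart i)) e)

      module LogDerivative (y : Fin m → ℂ) where
        open Evaluation.Taylor.Pairing complexField a complexField (Evaluation.eval-hom complexField a) y public

        D : Poly (Fin n) → ℂ
        D = pairing ∘ substitute σ

        open Derivation ev D (λ _ → refl) (λ _ _ → refl) (λ _ _ → refl) (λ _ → refl)
          pairing-con
          (λ f g → pairing-⊕ (substitute σ f) (substitute σ g))
          (λ f g → pairing-⊗ (substitute σ f) (substitute σ g))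
          (λ f → pairing-⊝ (substitute σ f)) public

        z : Fin n → ℂ
        z i = D (var i) * reciprocal (ev (var i))

        log-var : ∀ i → D (var i) ≈ z i * ev (var i)
        log-var i = sym (trans (C.*-assoc (D (var i)) _ _)
          (trans (*-congˡ (trans (C.*-comm _ _) (*-reciprocal _ (ev-var≉0 i)))) (C.*-identityʳ _)))

      F≈0 : ∀ i → ev (eigenPolynomial μ 𝒜 i) ≈ 0#
      -- The direction 0 is a placeholder: `ev` does not depend on the direction of differentiation.
      F≈0 = LogDerivative.ev-eigenPolynomial (λ _ → 0#) μ 𝒜 (eigenEquation-scale c≉0 chart p∈𝕍)

      open JacobianCriterion discreteComplexField (AtPoint.localization a) a (AtPoint.fromS a)
        (dehomogenize j ∘ eigenPolynomial μ 𝒜)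

      trivialKernel : ∀ y → (∀ i → jacobian i ∙ y ≈ 0#) → ∀ l → y l ≈ 0#
      trivialKernel y Jy≈0 l = begin
        y l                          ≈⟨ pairing-var l ⟨
        pairing (var l)              ≡⟨ ≡.cong pairing (insertAt-punchIn var j (con 1#) l) ⟨
        D (var k)                    ≈⟨ log-var k ⟩
        z k * ev (var k)             ≈⟨ *-congʳ (constant c≉0 chart z kernel k j) ⟩
        z j * ev (var k)             ≈⟨ *-congʳ (trans (*-congʳ Dj≈0) (C.zeroˡ _)) ⟩
        0# * ev (var k)              ≈⟨ C.zeroˡ _ ⟩
        0# ∎
        where
        open import Relation.Binary.Reasoning.Setoid C.setoid
        open LogDerivative y
        k : Fin n
        k = punchIn j l
        Dj≈0 : D (var j) ≈ 0#
        Dj≈0 = trans (C.reflexive (≡.cong pairing (insertAt-lookup var j (con 1#)))) (pairing-con 1#)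
        kernel : ∀ i → Σ-indices complexField id r (λ v →
          sum (λ t → z i - z (lookup v t)) * (𝒜 (i ∷ v) * monomial complexField id v (ev ∘ var))) ≈ 0#
        -- `jacobian i ∙ y` is by definition `D (eigenPolynomial μ 𝒜 i)`, so `Jy≈0 i` serves as the
        -- vanishing of the derivative.
        kernel i = log-eigenPolynomial z log-var μ 𝒜 i (F≈0 i) (Jy≈0 i)

      chart-dimension-1 : HasDimension complexField
        (localAlgebra a (dehomogenize j ∘ eigenPolynomial μ 𝒜)) (AtPoint.fromS a ∘ con) 1
      chart-dimension-1 = trivialKernel⇒dimension-1 (atPoint-isLocalization ℝ a) F≈0 trivialKernel

open import Data.Nat.Base using (_≤_; s≤s; z≤n)

lemma5p3 : (ℝ : CompleteOrderedField) →
    let open Tensors ℝ in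
    (r m : ℕ) → 2 ≤ suc r → 2 ≤ suc m →
    (𝒜 : Tensor (suc r) (suc m)) →
    Symmetric 𝒜 →
    WeaklyIrreducible 𝒜 →
    (∀ v → 𝒜 v ≉ 0# → AllEqual v ⊎ Unique v) →
    (μ : ℂ) → IsEigenvalue 𝒜 μ →
    (p : ℙ (suc m)) → IsolatedIn (𝕍 μ 𝒜) p →
    (∀ i → coord p i ≉ 0#) →
    (∃₂ λ α u → u IsExpOf imaginary α
    × (∀ v → Unique v → 𝒜 v ≉ 0# →
    edgeTerm 𝒜 p v ≈ real ∣ edgeTerm 𝒜 p v ∣ * u)) →
    HasMultiplicity μ 𝒜 p 1
lemma5p3 ℝ r (suc m) _ (s≤s (s≤s z≤n)) 𝒜 _ irreducible support μ _ p (p∈𝕍 , _) p≉0 (_ , u , _ , phase)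
  j q (c , c≉0 , q≈cp) qj≈1 = chart-dimension-1 p∈𝕍 j (removeAt (coord q) j) c≉0
    -- Reinserting 1 at position j recovers q, because q is normalized there; so the chart point is
    -- c times p in every coordinate.
    (punchIn-elim _ j
      (C.trans (C.reflexive (≡.cong (eval _) (insertAt-lookup var j (con 1#)))) (C.trans (C.sym qj≈1) (q≈cp j)))
      (λ l → C.trans (C.reflexive (≡.cong (eval _) (insertAt-punchIn var j (con 1#) l))) (q≈cp (punchIn j l))))
  where
  open Tensors ℝ
  -- Dimension at least 2 supplies the distinct vertices 0 and 1 that keep u away from zero.
  open EdgeWeights.Incidence ℝ 𝒜 irreducible (zero , suc zero , λ ()) support p p≉0 u phase
  module C = CommutativeRing complexField
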